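{- Let $\lambda$ be a nonzero real number and let $x,y\in\mathbb{R}$. For every integer $n\ge 0$, $$\beta_{n,\lambda}^{(c)}(1-x,y)=(-1)^{n}\beta_{n,-\lambda}^{(c)}(x,y)$$ and $$\beta_{n,\lambda}^{(s)}(1-x,y)=(-1)^{n+1}\beta_{n,-\lambda}^{(s)}(x,y).$$
   Context: All generating functions are power series in $t$ around $t=0$. For nonzero $\lambda\in\mathbb{R}$ and complex $z$, the degenerate exponential is $e_\lambda^{z}(t)=(1+\lambda t)^{z/\lambda}$, and $e_\lambda(t)=e_\lambda^1(t)$. The degenerate cosine and sine functions are $\cos_\lambda^{(y)}(t)=\frac{e_\lambda^{iy}(t)+e_\lambda^{ -iy}(t)}{2}=\cos\left(\frac{y}{\lambda}\log(1+\lambda t)\right)$ and $\sin_\lambda^{(y)}(t)=\frac{e_\lambda^{iy}(t)-e_\lambda^{ -iy}(t)}{2i}=\sin\left(\frac{y}{\lambda}\log(1+\lambda t)\right)$, with $i=\sqrt{ -1}$. For any nonzero real $\lambda$ (positive or negative), the degenerate cosine-Bernoulli and sine-Bernoulli polynomials are defined by $\frac{t}{e_\lambda(t)-1}e_\lambda^{x}(t)\cos_\lambda^{(y)}(t)=\sum_{n=0}^{\infty}\beta_{n,\lambda}^{(c)}(x,y)\frac{t^n}{n!}$ and $\frac{t}{e_\lambda(t)-1}e_\lambda^{x}(t)\sin_\lambda^{(y)}(t)=\sum_{n=0}^{\infty}\beta_{n,\lambda}^{(s)}(x,y)\frac{t^n}{n!}$. -}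

module Defs where

open import Level as Level using (0ℓ)
open import Data.Nat.Base as ℕ using (ℕ; zero; suc; _∸_; _!)
import Data.Nat.Properties as ℕₚ
open import Data.Integer.Base using (+_)
open import Data.Rational.Base as ℚ using (ℚ; 0ℚ; 1ℚ; ½; ∣_∣)
import Data.Rational.Properties as ℚₚ
open import Data.Rational.Solver using (module +-*-Solver)
open import Data.Fin.Base using (Fin; zero; suc; toℕ)
open import Data.Vec.Base as Vec using (Vec; []; _∷_)
open import Data.Maybe.Base using (Maybe; just; nothing)
open import Data.Product.Base using (∃; _×_; _,_; proj₁; proj₂)
open import Relation.Nullary using (yes; no; contradiction)
open import Relation.Binary.PropositionalEquality
  using (_≡_; _≢_; refl; sym; trans; cong; cong₂; subst; subst₂)
open import Relation.Binary.Structures using (IsEquivalence)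
open import Algebra.Structures using (IsCommutativeRing)
open import Algebra.Bundles using (CommutativeRing)
import Algebra.Definitions as AlgDefs
import Algebra.Properties.Semiring.Sum as SemiringSum
import Algebra.Properties.Semiring.Exp as SemiringExp
import Algebra.Properties.Ring as RingProps
import Algebra.Solver.Ring as RingSolver
open import Algebra.Solver.Ring.AlmostCommutativeRing
  using (AlmostCommutativeRing; fromCommutativeRing; _-Raw-AlmostCommutative⟶_)

private
  halves : ∀ ε → ½ ℚ.* ε ℚ.+ ½ ℚ.* ε ≡ ε
  halves ε = trans (sym (ℚₚ.*-distribʳ-+ ε ½ ½)) (ℚₚ.*-identityˡ ε)

  half>0 : ∀ ε → 0ℚ ℚ.< ε → 0ℚ ℚ.< ½ ℚ.* ε
  half>0 ε ε>0 = subst (ℚ._< ½ ℚ.* ε) (ℚₚ.*-zeroʳ ½) (ℚₚ.*-monoʳ-<-pos ½ ε>0)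

  add-halves : ∀ p q ε → p ℚ.< ½ ℚ.* ε → q ℚ.< ½ ℚ.* ε → p ℚ.+ q ℚ.< ε
  add-halves p q ε p< q< = subst (p ℚ.+ q ℚ.<_) (halves ε) (ℚₚ.+-mono-< p< q<)

  sum< : ∀ ε p q → ∣ p ∣ ℚ.< ½ ℚ.* ε → ∣ q ∣ ℚ.< ½ ℚ.* ε → ∣ p ℚ.+ q ∣ ℚ.< ε
  sum< ε p q p< q< = ℚₚ.≤-<-trans (ℚₚ.∣p+q∣≤∣p∣+∣q∣ p q) (add-halves ∣ p ∣ ∣ q ∣ ε p< q<)

  1/_>0 : ∀ {p} → 0ℚ ℚ.< p → ∃ λ r → 0ℚ ℚ.< r × p ℚ.* r ≡ 1ℚ
  1/_>0 {p} p>0 = (ℚ.1/ p) , ℚₚ.positive⁻¹ (ℚ.1/ p) {{ℚₚ.1/pos⇒pos p}} , ℚₚ.*-inverseʳ p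
    where instance
      pos : ℚ.Positive p
      pos = ℚ.positive p>0
      nz : ℚ.NonZero p
      nz = ℚₚ.pos⇒nonZero p

  prod< : ∀ A ε → 0ℚ ℚ.< A → 0ℚ ℚ.< ε →
          ∃ λ δ → 0ℚ ℚ.< δ × (∀ p q → ∣ p ∣ ℚ.≤ A → ∣ q ∣ ℚ.< δ → ∣ p ℚ.* q ∣ ℚ.< ε)
  prod< A ε A>0 ε>0 with 1/_>0 A>0
  ... | r , r>0 , Ar≡1 = r ℚ.* ε , δ>0 , bound
    where
    instance
      posA : ℚ.Positive A
      posA = ℚ.positive A>0
      posr : ℚ.Positive r
      posr = ℚ.positive r>0
    δ>0 : 0ℚ ℚ.< r ℚ.* ε
    δ>0 = subst (ℚ._< r ℚ.* ε) (ℚₚ.*-zeroʳ r) (ℚₚ.*-monoʳ-<-pos r ε>0)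
    Aδ≡ε : A ℚ.* (r ℚ.* ε) ≡ ε
    Aδ≡ε = trans (sym (ℚₚ.*-assoc A r ε)) (trans (cong (ℚ._* ε) Ar≡1) (ℚₚ.*-identityˡ ε))
    bound : ∀ p q → ∣ p ∣ ℚ.≤ A → ∣ q ∣ ℚ.< r ℚ.* ε → ∣ p ℚ.* q ∣ ℚ.< ε
    bound p q p≤ q< = subst₂ ℚ._<_ (sym (ℚₚ.∣p*q∣≡∣p∣*∣q∣ p q)) Aδ≡ε
      (ℚₚ.≤-<-trans
        (ℚₚ.*-monoʳ-≤-nonNeg ∣ q ∣ {{ℚ.nonNegative (ℚₚ.0≤∣p∣ q)}} p≤)
        (ℚₚ.*-monoʳ-<-pos A q<))

  ∣p-q∣-comm : ∀ p q → ∣ p ℚ.- q ∣ ≡ ∣ q ℚ.- p ∣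
  ∣p-q∣-comm p q = trans (sym (ℚₚ.∣-p∣≡∣p∣ (p ℚ.- q))) (cong ∣_∣ (flip p q))
    where
    open +-*-Solver
    flip : ∀ p q → ℚ.- (p ℚ.- q) ≡ q ℚ.- p
    flip = solve 2 (λ a b → :- (a :- b) := b :- a) refl

  ∣p∣≢0 : ∀ {δ} p → 0ℚ ℚ.< δ → δ ℚ.≤ ∣ p ∣ → p ≢ 0ℚ
  ∣p∣≢0 p δ>0 δ≤ refl = ℚₚ.<-irrefl refl (ℚₚ.<-≤-trans δ>0 δ≤)

  sub-+ : ∀ a b c d → (a ℚ.+ b) ℚ.- (c ℚ.+ d) ≡ (a ℚ.- c) ℚ.+ (b ℚ.- d)
  sub-+ = solve 4 (λ a b c d → (a :+ b) :- (c :+ d) := (a :- c) :+ (b :- d)) refl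
    where open +-*-Solver

  sub-* : ∀ a b c d → (a ℚ.* b) ℚ.- (c ℚ.* d) ≡ a ℚ.* (b ℚ.- d) ℚ.+ d ℚ.* (a ℚ.- c)
  sub-* = solve 4 (λ a b c d → (a :* b) :- (c :* d) := a :* (b :- d) :+ d :* (a :- c)) refl
    where open +-*-Solver

  sub-neg : ∀ a b → (ℚ.- a) ℚ.- (ℚ.- b) ≡ b ℚ.- a
  sub-neg = solve 2 (λ a b → :- a :- (:- b) := b :- a) refl
    where open +-*-Solver

  sub-trans : ∀ a b c → a ℚ.- c ≡ (a ℚ.- b) ℚ.+ (b ℚ.- c)
  sub-trans = solve 3 (λ a b c → a :- c := (a :- b) :+ (b :- c)) refl
    where open +-*-Solver

  sub-0 : ∀ a → a ℚ.- 0ℚ ≡ a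
  sub-0 = ℚₚ.+-identityʳ

  back : ∀ a b → a ≡ b ℚ.+ (a ℚ.- b)
  back = solve 2 (λ a b → a := b :+ (a :- b)) refl
    where open +-*-Solver

-- Total, with 0⁻¹ = 0.
invℚ : ℚ → ℚ
invℚ p with p ℚₚ.≟ 0ℚ
... | yes _  = 0ℚ
... | no p≢0 = ℚ.1/_ p {{ℚ.≢-nonZero p≢0}}

invℚ-inverseʳ : ∀ p → p ≢ 0ℚ → p ℚ.* invℚ p ≡ 1ℚ
invℚ-inverseʳ p p≢0 with p ℚₚ.≟ 0ℚ
... | yes p≡0 = contradiction p≡0 p≢0
... | no p≢0′ = ℚₚ.*-inverseʳ p {{ℚ.≢-nonZero p≢0′}}

-- Reals are Cauchy sequences of rationals; x ≃ y when the difference is a null sequence.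
Cauchy : (ℕ → ℚ) → Set
Cauchy a = ∀ ε → 0ℚ ℚ.< ε →
  ∃ λ N → ∀ m n → N ℕ.≤ m → N ℕ.≤ n → ∣ a m ℚ.- a n ∣ ℚ.< ε

record ℝ : Set where
  constructor real
  field
    seq    : ℕ → ℚ
    cauchy : Cauchy seq
open ℝ public

infix  4 _≃_ _#_
infixl 6 _+ᴿ_ _-ᴿ_
infixl 7 _*ᴿ_
infix  8 -ᴿ_

record _≃_ (x y : ℝ) : Set where
  constructor null
  field
    close : ∀ ε → 0ℚ ℚ.< ε → ∃ λ N → ∀ n → N ℕ.≤ n → ∣ seq x n ℚ.- seq y n ∣ ℚ.< ε
open _≃_ public

-- Apartness: the positive form of x ≠ y, i.e. eventually |x - y| ≥ δ for a rational δ > 0.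
record _#_ (x y : ℝ) : Set where
  constructor apart
  field
    gap      : ℚ
    gap>0    : 0ℚ ℚ.< gap
    from     : ℕ
    distance : ∀ n → from ℕ.≤ n → gap ℚ.≤ ∣ seq x n ℚ.- seq y n ∣
open _#_ public

private
  ≤⊔ˡ : ∀ {m n k} → m ℕ.⊔ n ℕ.≤ k → m ℕ.≤ k
  ≤⊔ˡ {m} {n} = ℕₚ.m⊔n≤o⇒m≤o m n

  ≤⊔ʳ : ∀ {m n k} → m ℕ.⊔ n ℕ.≤ k → n ℕ.≤ k
  ≤⊔ʳ {m} {n} = ℕₚ.m⊔n≤o⇒n≤o m n

  bounded : ∀ x → ∃ λ B → 0ℚ ℚ.< B × ∃ λ N → ∀ n → N ℕ.≤ n → ∣ seq x n ∣ ℚ.≤ B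
  bounded x with cauchy x 1ℚ (ℚₚ.positive⁻¹ 1ℚ)
  ... | N , near = ∣ seq x N ∣ ℚ.+ 1ℚ
      , ℚₚ.+-mono-≤-< (ℚₚ.0≤∣p∣ (seq x N)) (ℚₚ.positive⁻¹ 1ℚ)
      , N
      , λ n N≤n → ℚₚ.≤-trans
          (subst (λ p → ∣ p ∣ ℚ.≤ ∣ seq x N ∣ ℚ.+ ∣ seq x n ℚ.- seq x N ∣)
            (sym (back (seq x n) (seq x N)))
            (ℚₚ.∣p+q∣≤∣p∣+∣q∣ (seq x N) (seq x n ℚ.- seq x N)))
          (ℚₚ.+-monoʳ-≤ ∣ seq x N ∣ (ℚₚ.<⇒≤ (near n N N≤n ℕₚ.≤-refl)))

  abstract
    const-cauchy : ∀ q → Cauchy (λ _ → q)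
    const-cauchy q ε ε>0 = 0 , λ _ _ _ _ →
      subst (λ p → ∣ p ∣ ℚ.< ε) (sym (ℚₚ.+-inverseʳ q)) ε>0

    +-cauchy : ∀ x y → Cauchy (λ n → seq x n ℚ.+ seq y n)
    +-cauchy x y ε ε>0 with cauchy x (½ ℚ.* ε) (half>0 ε ε>0) | cauchy y (½ ℚ.* ε) (half>0 ε ε>0)
    ... | M , p | N , q = M ℕ.⊔ N , λ m n m≥ n≥ →
      subst (λ r → ∣ r ∣ ℚ.< ε) (sym (sub-+ (seq x m) (seq y m) (seq x n) (seq y n)))
        (sum< ε (seq x m ℚ.- seq x n) (seq y m ℚ.- seq y n)
          (p m n (≤⊔ˡ m≥) (≤⊔ˡ n≥)) (q m n (≤⊔ʳ {M} m≥) (≤⊔ʳ {M} n≥)))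

    neg-cauchy : ∀ x → Cauchy (λ n → ℚ.- seq x n)
    neg-cauchy x ε ε>0 with cauchy x ε ε>0
    ... | N , p = N , λ m n m≥ n≥ →
      subst (λ r → ∣ r ∣ ℚ.< ε) (sym (sub-neg (seq x m) (seq x n))) (p n m n≥ m≥)

    *-cauchy : ∀ x y → Cauchy (λ n → seq x n ℚ.* seq y n)
    *-cauchy x y ε ε>0 =
      let (A , A>0 , K , x≤) = bounded x
          (B , B>0 , L , y≤) = bounded y
          (δ , δ>0 , f) = prod< A (½ ℚ.* ε) A>0 (half>0 ε ε>0)
          (η , η>0 , g) = prod< B (½ ℚ.* ε) B>0 (half>0 ε ε>0)
          (M , u) = cauchy y δ δ>0
          (N , v) = cauchy x η η>0
      in (K ℕ.⊔ L) ℕ.⊔ (M ℕ.⊔ N) , λ m n m≥ n≥ →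
      subst (λ r → ∣ r ∣ ℚ.< ε) (sym (sub-* (seq x m) (seq y m) (seq x n) (seq y n)))
        (sum< ε (seq x m ℚ.* (seq y m ℚ.- seq y n)) (seq y n ℚ.* (seq x m ℚ.- seq x n))
          (f (seq x m) (seq y m ℚ.- seq y n) (x≤ m (≤⊔ˡ (≤⊔ˡ m≥)))
            (u m n (≤⊔ˡ (≤⊔ʳ {K ℕ.⊔ L} m≥)) (≤⊔ˡ (≤⊔ʳ {K ℕ.⊔ L} n≥))))
          (g (seq y n) (seq x m ℚ.- seq x n) (y≤ n (≤⊔ʳ {K} (≤⊔ˡ n≥)))
            (v m n (≤⊔ʳ {M} (≤⊔ʳ {K ℕ.⊔ L} m≥)) (≤⊔ʳ {M} (≤⊔ʳ {K ℕ.⊔ L} n≥)))))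

-- The operations are opaque so that type checking never unfolds into ℚ.
opaque
  fromℚ : ℚ → ℝ
  fromℚ q = real (λ _ → q) (const-cauchy q)

  _+ᴿ_ : ℝ → ℝ → ℝ
  x +ᴿ y = real (λ n → seq x n ℚ.+ seq y n) (+-cauchy x y)

  -ᴿ_ : ℝ → ℝ
  -ᴿ x = real (λ n → ℚ.- seq x n) (neg-cauchy x)

  _*ᴿ_ : ℝ → ℝ → ℝ
  x *ᴿ y = real (λ n → seq x n ℚ.* seq y n) (*-cauchy x y)

_-ᴿ_ : ℝ → ℝ → ℝ
x -ᴿ y = x +ᴿ (-ᴿ y)

0ℝ 1ℝ : ℝ
0ℝ = fromℚ 0ℚ
1ℝ = fromℚ 1ℚ

private
  -- δ ≤ |p| gives |1/p| ≤ 1/δ.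
  invℚ-bound : ∀ {δ} → 0ℚ ℚ.< δ →
    ∃ λ D → 0ℚ ℚ.< D × (∀ p → δ ℚ.≤ ∣ p ∣ → ∣ invℚ p ∣ ℚ.≤ D)
  invℚ-bound {δ} δ>0 with 1/_>0 δ>0
  ... | D , D>0 , δD≡1 = D , D>0 , λ p δ≤ →
    ℚₚ.*-cancelˡ-≤-pos δ {{ℚ.positive δ>0}}
      (subst (δ ℚ.* ∣ invℚ p ∣ ℚ.≤_)
        (trans (sym (ℚₚ.∣p*q∣≡∣p∣*∣q∣ p (invℚ p)))
          (trans (cong ∣_∣ (invℚ-inverseʳ p (∣p∣≢0 p δ>0 δ≤))) (sym δD≡1)))
        (ℚₚ.*-monoʳ-≤-nonNeg ∣ invℚ p ∣ {{ℚ.nonNegative (ℚₚ.0≤∣p∣ (invℚ p))}} δ≤))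

  invℚ-sub : ∀ p q → p ≢ 0ℚ → q ≢ 0ℚ →
             invℚ p ℚ.- invℚ q ≡ invℚ p ℚ.* (invℚ q ℚ.* (q ℚ.- p))
  invℚ-sub p q p≢0 q≢0 = trans
    (cong₂ ℚ._-_ (sym (ℚₚ.*-identityʳ (invℚ p))) (sym (ℚₚ.*-identityʳ (invℚ q))))
    (trans
      (cong₂ (λ u v → invℚ p ℚ.* u ℚ.- invℚ q ℚ.* v)
        (sym (invℚ-inverseʳ q q≢0)) (sym (invℚ-inverseʳ p p≢0)))
      (rearrange p q (invℚ p) (invℚ q)))
    where
    open +-*-Solver
    rearrange : ∀ p q a b → a ℚ.* (q ℚ.* b) ℚ.- b ℚ.* (p ℚ.* a) ≡ a ℚ.* (b ℚ.* (q ℚ.- p))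
    rearrange = solve 4 (λ p q a b → a :* (q :* b) :- b :* (p :* a) := a :* (b :* (q :- p))) refl

  opaque
    unfolding fromℚ

    away : ∀ {x} (h : x # 0ℝ) n → from h ℕ.≤ n → gap h ℚ.≤ ∣ seq x n ∣
    away {x} h n n≥ = subst (λ p → gap h ℚ.≤ ∣ p ∣) (sub-0 (seq x n)) (distance h n n≥)

  abstract
    inv-cauchy : ∀ x → x # 0ℝ → Cauchy (λ n → invℚ (seq x n))
    inv-cauchy x h ε ε>0 =
      let (D , D>0 , bd) = invℚ-bound (gap>0 h)
          (δ , δ>0 , f) = prod< D ε D>0 ε>0
          (η , η>0 , g) = prod< D δ D>0 δ>0
          (N , p) = cauchy x η η>0
      in from h ℕ.⊔ N , λ m n m≥ n≥ →
      let a  = seq x m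
          b  = seq x n
          a≤ = away h m (≤⊔ˡ m≥)
          b≤ = away h n (≤⊔ˡ n≥)
      in subst (λ r → ∣ r ∣ ℚ.< ε)
           (sym (invℚ-sub a b (∣p∣≢0 a (gap>0 h) a≤) (∣p∣≢0 b (gap>0 h) b≤)))
           (f (invℚ a) (invℚ b ℚ.* (b ℚ.- a)) (bd a a≤)
             (g (invℚ b) (b ℚ.- a) (bd b b≤)
               (p n m (≤⊔ʳ {from h} n≥) (≤⊔ʳ {from h} m≥))))

infix 9 _⁻¹[_]
opaque
  _⁻¹[_] : ∀ x → x # 0ℝ → ℝ
  x ⁻¹[ x#0 ] = real (λ n → invℚ (seq x n)) (inv-cauchy x x#0)

opaque
  unfolding fromℚ -ᴿ_

  -‿#0 : ∀ {x} → x # 0ℝ → -ᴿ x # 0ℝ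
  -‿#0 {x} h = apart (gap h) (gap>0 h) (from h) λ n n≥ →
    subst (gap h ℚ.≤_)
      (trans (∣p-q∣-comm (seq x n) 0ℚ)
        (cong ∣_∣ (trans (ℚₚ.+-identityˡ (ℚ.- seq x n)) (sym (sub-0 (ℚ.- seq x n))))))
      (distance h n n≥)

pointwise : ∀ {x y} → (∀ n → seq x n ≡ seq y n) → x ≃ y
pointwise {x} {y} eq = null λ ε ε>0 → 0 , λ n _ → subst (λ p → ∣ p ∣ ℚ.< ε)
  (sym (trans (cong (ℚ._- seq y n) (eq n)) (ℚₚ.+-inverseʳ (seq y n)))) ε>0

≃-isEquivalence : IsEquivalence _≃_
≃-isEquivalence = record
  { refl  = pointwise λ _ → refl
  ; sym   = λ {x} {y} p → null λ ε ε>0 → proj₁ (close p ε ε>0) , λ n n≥ →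
      subst (ℚ._< ε) (∣p-q∣-comm (seq x n) (seq y n)) (proj₂ (close p ε ε>0) n n≥)
  ; trans = λ {x} {y} {z} p q → null λ ε ε>0 →
      let (M , f) = close p (½ ℚ.* ε) (half>0 ε ε>0)
          (N , g) = close q (½ ℚ.* ε) (half>0 ε ε>0)
      in M ℕ.⊔ N , λ n n≥ → subst (λ r → ∣ r ∣ ℚ.< ε)
           (sym (sub-trans (seq x n) (seq y n) (seq z n)))
           (sum< ε (seq x n ℚ.- seq y n) (seq y n ℚ.- seq z n) (f n (≤⊔ˡ n≥)) (g n (≤⊔ʳ {M} n≥)))
  }

opaque
  unfolding _+ᴿ_ -ᴿ_ _*ᴿ_

  +ᴿ-cong : ∀ {x x′ y y′} → x ≃ x′ → y ≃ y′ → x +ᴿ y ≃ x′ +ᴿ y′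
  +ᴿ-cong {x} {x′} {y} {y′} p q = null λ ε ε>0 →
    let (M , f) = close p (½ ℚ.* ε) (half>0 ε ε>0)
        (N , g) = close q (½ ℚ.* ε) (half>0 ε ε>0)
    in M ℕ.⊔ N , λ n n≥ → subst (λ r → ∣ r ∣ ℚ.< ε)
         (sym (sub-+ (seq x n) (seq y n) (seq x′ n) (seq y′ n)))
         (sum< ε (seq x n ℚ.- seq x′ n) (seq y n ℚ.- seq y′ n) (f n (≤⊔ˡ n≥)) (g n (≤⊔ʳ {M} n≥)))

  -ᴿ-cong : ∀ {x x′} → x ≃ x′ → -ᴿ x ≃ -ᴿ x′
  -ᴿ-cong {x} {x′} p = null λ ε ε>0 → proj₁ (close p ε ε>0) , λ n n≥ →
    subst (ℚ._< ε)
      (trans (∣p-q∣-comm (seq x n) (seq x′ n)) (cong ∣_∣ (sym (sub-neg (seq x n) (seq x′ n)))))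
      (proj₂ (close p ε ε>0) n n≥)

  *ᴿ-cong : ∀ {x x′ y y′} → x ≃ x′ → y ≃ y′ → x *ᴿ y ≃ x′ *ᴿ y′
  *ᴿ-cong {x} {x′} {y} {y′} p q = null λ ε ε>0 →
    let (A , A>0 , K , x≤) = bounded x
        (B , B>0 , L , y≤) = bounded y′
        (δ , δ>0 , f) = prod< A (½ ℚ.* ε) A>0 (half>0 ε ε>0)
        (η , η>0 , g) = prod< B (½ ℚ.* ε) B>0 (half>0 ε ε>0)
        (M , u) = close q δ δ>0
        (N , v) = close p η η>0
    in (K ℕ.⊔ L) ℕ.⊔ (M ℕ.⊔ N) , λ n n≥ → subst (λ r → ∣ r ∣ ℚ.< ε)
         (sym (sub-* (seq x n) (seq y n) (seq x′ n) (seq y′ n)))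
         (sum< ε (seq x n ℚ.* (seq y n ℚ.- seq y′ n)) (seq y′ n ℚ.* (seq x n ℚ.- seq x′ n))
           (f (seq x n) (seq y n ℚ.- seq y′ n) (x≤ n (≤⊔ˡ (≤⊔ˡ n≥)))
             (u n (≤⊔ˡ (≤⊔ʳ {K ℕ.⊔ L} n≥))))
           (g (seq y′ n) (seq x n ℚ.- seq x′ n) (y≤ n (≤⊔ʳ {K} (≤⊔ˡ n≥)))
             (v n (≤⊔ʳ {M} (≤⊔ʳ {K ℕ.⊔ L} n≥)))))

opaque
  unfolding fromℚ _+ᴿ_ -ᴿ_ _*ᴿ_

  ℝ-isCommutativeRing : IsCommutativeRing _≃_ _+ᴿ_ _*ᴿ_ -ᴿ_ 0ℝ 1ℝ
  ℝ-isCommutativeRing = record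
    { isRing = record
      { +-isAbelianGroup = record
        { isGroup = record
          { isMonoid = record
            { isSemigroup = record
              { isMagma = record { isEquivalence = ≃-isEquivalence ; ∙-cong = +ᴿ-cong }
              ; assoc = λ x y z → pointwise λ n → ℚₚ.+-assoc (seq x n) (seq y n) (seq z n)
              }
            ; identity = (λ x → pointwise λ n → ℚₚ.+-identityˡ (seq x n))
                       , (λ x → pointwise λ n → ℚₚ.+-identityʳ (seq x n))
            }
          ; inverse = (λ x → pointwise λ n → ℚₚ.+-inverseˡ (seq x n))
                    , (λ x → pointwise λ n → ℚₚ.+-inverseʳ (seq x n))
          ; ⁻¹-cong = -ᴿ-cong
          }
        ; comm = λ x y → pointwise λ n → ℚₚ.+-comm (seq x n) (seq y n)
        }
      ; *-cong = *ᴿ-cong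
      ; *-assoc = λ x y z → pointwise λ n → ℚₚ.*-assoc (seq x n) (seq y n) (seq z n)
      ; *-identity = (λ x → pointwise λ n → ℚₚ.*-identityˡ (seq x n))
                   , (λ x → pointwise λ n → ℚₚ.*-identityʳ (seq x n))
      ; distrib = (λ x y z → pointwise λ n → ℚₚ.*-distribˡ-+ (seq x n) (seq y n) (seq z n))
                , (λ x y z → pointwise λ n → ℚₚ.*-distribʳ-+ (seq x n) (seq y n) (seq z n))
      }
    ; *-comm = λ x y → pointwise λ n → ℚₚ.*-comm (seq x n) (seq y n)
    }

  fromℚ-+ : ∀ p q → fromℚ (p ℚ.+ q) ≃ fromℚ p +ᴿ fromℚ q
  fromℚ-+ p q = pointwise λ _ → refl

  fromℚ-* : ∀ p q → fromℚ (p ℚ.* q) ≃ fromℚ p *ᴿ fromℚ q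
  fromℚ-* p q = pointwise λ _ → refl

  fromℚ-neg : ∀ p → fromℚ (ℚ.- p) ≃ -ᴿ fromℚ p
  fromℚ-neg p = pointwise λ _ → refl

ℝ-commutativeRing : CommutativeRing 0ℓ 0ℓ
ℝ-commutativeRing = record { isCommutativeRing = ℝ-isCommutativeRing }

opaque
  unfolding fromℚ _*ᴿ_ _⁻¹[_]

  ⁻¹-inverseˡ : ∀ x (x#0 : x # 0ℝ) → x ⁻¹[ x#0 ] *ᴿ x ≃ 1ℝ
  ⁻¹-inverseˡ x h = null λ ε ε>0 → from h , λ n n≥ → subst (λ r → ∣ r ∣ ℚ.< ε)
    (sym (trans
      (cong (ℚ._- 1ℚ) (trans (ℚₚ.*-comm (invℚ (seq x n)) (seq x n))
        (invℚ-inverseʳ (seq x n) (∣p∣≢0 (seq x n) (gap>0 h) (away h n n≥)))))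
      (ℚₚ.+-inverseʳ 1ℚ)))
    ε>0

infix  4 _≈_
infixl 6 _+ᶜ_ _-ᶜ_
infixl 7 _*ᶜ_
infix  8 -ᶜ_

record ℂ : Set where
  constructor complex
  field
    re im : ℝ
open ℂ public

record _≈_ (z w : ℂ) : Set where
  constructor _,_
  field
    re≃ : re z ≃ re w
    im≃ : im z ≃ im w
open _≈_ public

fromℝ : ℝ → ℂ
fromℝ x = complex x 0ℝ

ratℂ : ℚ → ℂ
ratℂ q = fromℝ (fromℚ q)

0ℂ 1ℂ 𝕚 : ℂ
0ℂ = fromℝ 0ℝ
1ℂ = fromℝ 1ℝ
𝕚  = complex 0ℝ 1ℝ

_+ᶜ_ : ℂ → ℂ → ℂ
z +ᶜ w = complex (re z +ᴿ re w) (im z +ᴿ im w)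

-ᶜ_ : ℂ → ℂ
-ᶜ z = complex (-ᴿ re z) (-ᴿ im z)

_-ᶜ_ : ℂ → ℂ → ℂ
z -ᶜ w = z +ᶜ (-ᶜ w)

_*ᶜ_ : ℂ → ℂ → ℂ
z *ᶜ w = complex (re z *ᴿ re w -ᴿ im z *ᴿ im w) (re z *ᴿ im w +ᴿ im z *ᴿ re w)

private
  module R = CommutativeRing ℝ-commutativeRing

  ℝ-acr : AlmostCommutativeRing 0ℓ 0ℓ
  ℝ-acr = fromCommutativeRing ℝ-commutativeRing

  ℚ⟶ℝ : CommutativeRing.rawRing ℚₚ.+-*-commutativeRing -Raw-AlmostCommutative⟶ ℝ-acr
  ℚ⟶ℝ = record
    { ⟦_⟧ = fromℚ ; +-homo = fromℚ-+ ; *-homo = fromℚ-* ; -‿homo = fromℚ-neg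
    ; 0-homo = R.refl ; 1-homo = R.refl }

  coeff≟ : ∀ p q → Maybe (fromℚ p ≃ fromℚ q)
  coeff≟ p q with p ℚₚ.≟ q
  ... | yes p≡q = just (R.reflexive (cong fromℚ p≡q))
  ... | no _    = nothing

  module ℝ-Solver = RingSolver (CommutativeRing.rawRing ℚₚ.+-*-commutativeRing) ℝ-acr ℚ⟶ℝ coeff≟
  open ℝ-Solver

  *ᶜ-assoc : ∀ z w v → (z *ᶜ w) *ᶜ v ≈ z *ᶜ (w *ᶜ v)
  *ᶜ-assoc z w v =
    solve 6 (λ a b c d e f →
        (a :* c :- b :* d) :* e :- (a :* d :+ b :* c) :* f
      := a :* (c :* e :- d :* f) :- b :* (c :* f :+ d :* e))
      R.refl (re z) (im z) (re w) (im w) (re v) (im v) ,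
    solve 6 (λ a b c d e f →
        (a :* c :- b :* d) :* f :+ (a :* d :+ b :* c) :* e
      := a :* (c :* f :+ d :* e) :+ b :* (c :* e :- d :* f))
      R.refl (re z) (im z) (re w) (im w) (re v) (im v)

  *ᶜ-comm : ∀ z w → z *ᶜ w ≈ w *ᶜ z
  *ᶜ-comm z w =
    solve 4 (λ a b c d → a :* c :- b :* d := c :* a :- d :* b)
      R.refl (re z) (im z) (re w) (im w) ,
    solve 4 (λ a b c d → a :* d :+ b :* c := c :* b :+ d :* a)
      R.refl (re z) (im z) (re w) (im w)

  *ᶜ-distribˡ : ∀ z w v → z *ᶜ (w +ᶜ v) ≈ z *ᶜ w +ᶜ z *ᶜ v
  *ᶜ-distribˡ z w v =
    solve 6 (λ a b c d e f →
        a :* (c :+ e) :- b :* (d :+ f)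
      := (a :* c :- b :* d) :+ (a :* e :- b :* f))
      R.refl (re z) (im z) (re w) (im w) (re v) (im v) ,
    solve 6 (λ a b c d e f →
        a :* (d :+ f) :+ b :* (c :+ e)
      := (a :* d :+ b :* c) :+ (a :* f :+ b :* e))
      R.refl (re z) (im z) (re w) (im w) (re v) (im v)

  *ᶜ-identityˡ : ∀ z → 1ℂ *ᶜ z ≈ z
  *ᶜ-identityˡ z =
    R.trans (R.+-cong (R.*-identityˡ (re z))
              (R.trans (R.-‿cong (R.zeroˡ (im z))) (RingProps.-0#≈0# R.ring)))
            (R.+-identityʳ (re z)) ,
    R.trans (R.+-cong (R.*-identityˡ (im z)) (R.zeroˡ (re z))) (R.+-identityʳ (im z))

≈-isEquivalence : IsEquivalence _≈_
≈-isEquivalence = record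
  { refl  = R.refl , R.refl
  ; sym   = λ p → R.sym (re≃ p) , R.sym (im≃ p)
  ; trans = λ p q → R.trans (re≃ p) (re≃ q) , R.trans (im≃ p) (im≃ q)
  }

*ᶜ-cong : ∀ {z z′ w w′} → z ≈ z′ → w ≈ w′ → z *ᶜ w ≈ z′ *ᶜ w′
*ᶜ-cong (a , b) (c , d) =
  R.+-cong (R.*-cong a c) (R.-‿cong (R.*-cong b d)) , R.+-cong (R.*-cong a d) (R.*-cong b c)

ℂ-commutativeRing : CommutativeRing 0ℓ 0ℓ
ℂ-commutativeRing = record
  { Carrier = ℂ ; _≈_ = _≈_ ; _+_ = _+ᶜ_ ; _*_ = _*ᶜ_ ; -_ = -ᶜ_ ; 0# = 0ℂ ; 1# = 1ℂ
  ; isCommutativeRing = record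
    { isRing = record
      { +-isAbelianGroup = record
        { isGroup = record
          { isMonoid = record
            { isSemigroup = record
              { isMagma = record
                { isEquivalence = ≈-isEquivalence
                ; ∙-cong = λ (a , b) (c , d) → R.+-cong a c , R.+-cong b d
                }
              ; assoc = λ z w v → R.+-assoc (re z) (re w) (re v) , R.+-assoc (im z) (im w) (im v)
              }
            ; identity = (λ z → R.+-identityˡ (re z) , R.+-identityˡ (im z))
                       , (λ z → R.+-identityʳ (re z) , R.+-identityʳ (im z))
            }
          ; inverse = (λ z → R.-‿inverseˡ (re z) , R.-‿inverseˡ (im z))
                    , (λ z → R.-‿inverseʳ (re z) , R.-‿inverseʳ (im z))
          ; ⁻¹-cong = λ (a , b) → R.-‿cong a , R.-‿cong b
          }
        ; comm = λ z w → R.+-comm (re z) (re w) , R.+-comm (im z) (im w)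
        }
      ; *-cong = *ᶜ-cong
      ; *-assoc = *ᶜ-assoc
      ; *-identity = *ᶜ-identityˡ
                   , (λ z → Trans (*ᶜ-comm z 1ℂ) (*ᶜ-identityˡ z))
      ; distrib = *ᶜ-distribˡ
                , (λ z w v → Trans (*ᶜ-comm (w +ᶜ v) z)
                    (Trans (*ᶜ-distribˡ z w v)
                      (R.+-cong (re≃ (*ᶜ-comm z w)) (re≃ (*ᶜ-comm z v))
                      , R.+-cong (im≃ (*ᶜ-comm z w)) (im≃ (*ᶜ-comm z v)))))
      }
    ; *-comm = *ᶜ-comm
    }
  }
  where open IsEquivalence ≈-isEquivalence using () renaming (trans to Trans)

module PowerSeries {c ℓ} (R : CommutativeRing c ℓ) where
  open CommutativeRing R hiding (zero) renaming (_≈_ to _≈ᴿ_; refl to ≈-refl; sym to ≈-sym; trans to ≈-trans)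
  open AlgDefs _≈ᴿ_ using (Invertible)
  open SemiringSum semiring using (sum; sum-cong-≋; sum-cong-≗; sum-replicate-zero)
  open SemiringExp semiring using (_^_)

  Series : Set c
  Series = ℕ → Carrier

  infix 4 _≋_
  infixl 6 _⊕_ _⊖_
  infixl 7 _⊛_ _•_

  _≋_ : Series → Series → Set ℓ
  f ≋ g = ∀ n → f n ≈ᴿ g n

  1ˢ X : Series
  1ˢ zero    = 1#
  1ˢ (suc _) = 0#
  X zero    = 0#
  X (suc n) = 1ˢ n

  _⊕_ _⊖_ _⊛_ : Series → Series → Series
  (f ⊕ g) n = f n + g n
  (f ⊖ g) n = f n - g n
  (f ⊛ g) n = sum {suc n} λ k → f (toℕ k) * g (n ∸ toℕ k)

  _•_ : Carrier → Series → Series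
  (a • f) n = a * f n

  -- f(a t)
  dilate : Carrier → Series → Series
  dilate a f n = f n * a ^ n

  private
    -- The coefficients bₙ, …, b₀ of 1/f, where u is the inverse of f₀.
    recips : Series → Carrier → ∀ n → Vec Carrier (suc n)
    recips f u zero    = u ∷ []
    recips f u (suc n) =
      - (u * sum {suc n} (λ k → f (suc (toℕ k)) * Vec.lookup (recips f u n) k)) ∷ recips f u n

    lookup-recips : ∀ f u n (k : Fin (suc n)) →
      Vec.lookup (recips f u n) k ≡ Vec.head (recips f u (n ∸ toℕ k))
    lookup-recips f u zero    zero    = refl
    lookup-recips f u (suc n) zero    = refl
    lookup-recips f u (suc n) (suc k) = lookup-recips f u n k

  recip : (f : Series) → Invertible 1# _*_ (f 0) → Series
  recip f (u , _) n = Vec.head (recips f u n)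

  recip-inverseʳ : ∀ f inv → f ⊛ recip f inv ≋ 1ˢ
  recip-inverseʳ f (u , _ , f₀u≈1) zero = ≈-trans (+-identityʳ _) f₀u≈1
  recip-inverseʳ f inv@(u , _ , f₀u≈1) (suc n) = begin
    f 0 * - (u * S) + sum {suc n} (λ k → f (suc (toℕ k)) * recip f inv (n ∸ toℕ k))
      ≡⟨ cong (_+_ (f 0 * - (u * S))) (sum-cong-≗ {suc n} λ k →
           cong (f (suc (toℕ k)) *_) (sym (lookup-recips f u n k))) ⟩
    f 0 * - (u * S) + S
      ≈⟨ +-congʳ (≈-sym (-‿distribʳ-* (f 0) (u * S))) ⟩
    - (f 0 * (u * S)) + S
      ≈⟨ +-congʳ (-‿cong (≈-trans (≈-sym (*-assoc (f 0) u S))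
           (≈-trans (*-congʳ f₀u≈1) (*-identityˡ S)))) ⟩
    - S + S
      ≈⟨ -‿inverseˡ S ⟩
    0# ∎
    where
    open RingProps ring using (-‿distribʳ-*)
    open import Relation.Binary.Reasoning.Setoid setoid
    S = sum {suc n} λ k → f (suc (toℕ k)) * Vec.lookup (recips f u n) k

  record SimpleZero (f : Series) : Set (c Level.⊔ ℓ) where
    constructor simpleZero
    field
      vanishes   : f 0 ≈ᴿ 0#
      invertible : Invertible 1# _*_ (f 1)

  -- t / f(t), as 1 / (f(t) / t).
  X/ : (f : Series) → SimpleZero f → Series
  X/ f h = recip (λ n → f (suc n)) (SimpleZero.invertible h)

  X/-correct : ∀ f h → f ⊛ X/ f h ≋ X
  X/-correct f h zero =
    ≈-trans (+-identityʳ _) (≈-trans (*-congʳ (SimpleZero.vanishes h)) (zeroˡ _))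
  X/-correct f h (suc n) =
    ≈-trans (+-cong (≈-trans (*-congʳ (SimpleZero.vanishes h)) (zeroˡ _))
                    (recip-inverseʳ (λ n → f (suc n)) (SimpleZero.invertible h) n))
            (+-identityˡ _)

open PowerSeries ℂ-commutativeRing public
open SemiringExp (CommutativeRing.semiring ℂ-commutativeRing) public using (_^_)

private module C = CommutativeRing ℂ-commutativeRing

ℕ→ℂ : ℕ → ℂ
ℕ→ℂ n = ratℂ (+ n ℚ./ 1)

1/!_ : ℕ → ℂ
1/! n = ratℂ (ℚ._/_ (+ 1) (n !) {{n ℕₚ.!≢0}})

-- z (z - 1) ⋯ (z - n + 1)
falling : ℂ → ℕ → ℂ
falling z zero    = 1ℂ
falling z (suc n) = falling z n *ᶜ (z -ᶜ ℕ→ℂ n)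

-- The Taylor series at 0: (1 + t)ᶻ = Σₙ z(z-1)⋯(z-n+1)/n! tⁿ
binomialSeries : ℂ → Series
binomialSeries z n = falling z n *ᶜ (1/! n)

-- e_λᶻ(t) = (1 + λt)^(z/λ)
e : (lam : ℝ) → lam # 0ℝ → ℂ → Series
e lam lam#0 z = dilate (fromℝ lam) (binomialSeries (z *ᶜ fromℝ (lam ⁻¹[ lam#0 ])))

cosˢ : (lam : ℝ) → lam # 0ℝ → ℝ → Series
cosˢ lam lam#0 y =
  ratℂ ½ • (e lam lam#0 (𝕚 *ᶜ fromℝ y) ⊕ e lam lam#0 (-ᶜ (𝕚 *ᶜ fromℝ y)))

-- 1/(2i)
1/2i : ℂ
1/2i = complex 0ℝ (-ᴿ fromℚ ½)

1/2i-inverse : (1ℂ +ᶜ 1ℂ) *ᶜ 𝕚 *ᶜ 1/2i ≈ 1ℂ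
1/2i-inverse =
  solve 0 (((con 1ℚ :+ con 1ℚ) :* con 0ℚ :- (con 0ℚ :+ con 0ℚ) :* con 1ℚ) :* con 0ℚ
           :- ((con 1ℚ :+ con 1ℚ) :* con 1ℚ :+ (con 0ℚ :+ con 0ℚ) :* con 0ℚ) :* :- con ½
           := con 1ℚ) R.refl ,
  solve 0 (((con 1ℚ :+ con 1ℚ) :* con 0ℚ :- (con 0ℚ :+ con 0ℚ) :* con 1ℚ) :* :- con ½
           :+ ((con 1ℚ :+ con 1ℚ) :* con 1ℚ :+ (con 0ℚ :+ con 0ℚ) :* con 0ℚ) :* con 0ℚ
           := con 0ℚ) R.refl

sinˢ : (lam : ℝ) → lam # 0ℝ → ℝ → Series
sinˢ lam lam#0 y =
  1/2i • (e lam lam#0 (𝕚 *ᶜ fromℝ y) ⊖ e lam lam#0 (-ᶜ (𝕚 *ᶜ fromℝ y)))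

e-1 : (lam : ℝ) → lam # 0ℝ → Series
e-1 lam lam#0 = e lam lam#0 1ℂ ⊖ 1ˢ

e-1-simpleZero : ∀ lam lam#0 → SimpleZero (e-1 lam lam#0)
e-1-simpleZero lam lam#0 = simpleZero
  (C.trans (C.+-congʳ {x = -ᶜ 1ℂ} (C.trans (C.*-identityʳ _) (C.*-identityʳ 1ℂ)))
           (C.-‿inverseʳ 1ℂ))
  (1ℂ , C.trans (C.*-identityˡ _) e₁≈1 , C.trans (C.*-identityʳ _) e₁≈1)
  where
  e₁≈1 : e-1 lam lam#0 1 ≈ 1ℂ
  e₁≈1 = R.trans
      (solve 2 (λ l m →
        let o = con 1ℚ ; z = con 0ℚ
            qr = (o :* m :- z :* z) :- z ; qi = (o :* z :+ z :* m) :- z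
            pr = o :* qr :- z :* qi ; pi = o :* qi :+ z :* qr
            br = pr :* o :- pi :* z ; bi = pr :* z :+ pi :* o
            lr = l :* o :- z :* z ; li = l :* z :+ z :* o
        in (br :* lr :- bi :* li) :- z := m :* l)
        R.refl lam (lam ⁻¹[ lam#0 ]))
      (⁻¹-inverseˡ lam lam#0)
    , solve 2 (λ l m →
        let o = con 1ℚ ; z = con 0ℚ
            qr = (o :* m :- z :* z) :- z ; qi = (o :* z :+ z :* m) :- z
            pr = o :* qr :- z :* qi ; pi = o :* qi :+ z :* qr
            br = pr :* o :- pi :* z ; bi = pr :* z :+ pi :* o
            lr = l :* o :- z :* z ; li = l :* z :+ z :* o
        in (br :* li :+ bi :* lr) :- z := z)
        R.refl lam (lam ⁻¹[ lam#0 ])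

-- t / (e_λ(t) - 1)
t/[e-1] : (lam : ℝ) → lam # 0ℝ → Series
t/[e-1] lam lam#0 = X/ (e-1 lam lam#0) (e-1-simpleZero lam lam#0)

-- The numbers aₙ with f(t) = Σₙ aₙ tⁿ/n!.
egf-coeff : Series → ℕ → ℂ
egf-coeff f n = ℕ→ℂ (n !) *ᶜ f n

-- Real-valued, but living in ℂ because cosˢ and sinˢ are built from complex exponentials.
β-cos β-sin : (lam : ℝ) → lam # 0ℝ → ℕ → (x y : ℝ) → ℂ
β-cos lam lam#0 n x y =
  egf-coeff (t/[e-1] lam lam#0 ⊛ e lam lam#0 (fromℝ x) ⊛ cosˢ lam lam#0 y) n
β-sin lam lam#0 n x y =
  egf-coeff (t/[e-1] lam lam#0 ⊛ e lam lam#0 (fromℝ x) ⊛ sinˢ lam lam#0 y) n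

{-# OPTIONS --safe #-}

-- Replacing (λ, t) by (-λ, -t) fixes λt and negates z/λ, so e_{-λ}ᶻ(-t) = e_λ⁻ᶻ(t).  Hence cos_λ is
-- fixed, sin_λ is negated, and
--   (-t) / (e_λ⁻¹(t) - 1) = e_λ(t) · t / (e_λ(t) - 1),
-- where the extra factor e_λ turns e_λ⁻ˣ into e_λ¹⁻ˣ.  The addition law e_λᶻ e_λʷ = e_λᶻ⁺ʷ holds because
-- both sides satisfy the same differential equation, which determines a series from its constant term.

module Submission where

open import Defs using (module PowerSeries)
open import Data.Nat.Base as ℕ using (ℕ; suc; zero; _!)
open import Data.Product.Base using (_×_; _,_)
open import Algebra.Bundles using (CommutativeRing)
open import Algebra.Structures using (IsAbelianGroup)
import Algebra.Construct.Pointwise as Pointwise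
import Algebra.Consequences.Setoid as Consequences
import Algebra.Properties.CommutativeMonoid.Mult as Mult
import Algebra.Properties.Semiring.Mult as SemiringMult
import Algebra.Properties.CommutativeSemiring.Exp as Exp
import Algebra.Properties.Ring as RingProperties
import Algebra.Properties.AbelianGroup as AbelianGroupProperties
import Algebra.Solver.Ring.NaturalCoefficients.Default as SemiringSolver
import Relation.Binary.Reasoning.Setoid as SetoidReasoning
import Data.Nat.Properties as ℕₚ
open import Data.Integer.Base as ℤ using (+_)
import Data.Integer.Properties as ℤₚ
import Data.Rational.Base as ℚ
import Data.Rational.Properties as ℚₚ
import Data.Rational.Unnormalised.Base as ℚᵘ
import Data.Rational.Unnormalised.Properties as ℚᵘₚ
open import Relation.Binary.PropositionalEquality as ≡ using (_≡_)

-- The ring of power series under the Cauchy product.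

module CauchyProduct {c ℓ} (R : CommutativeRing c ℓ) where
  open CommutativeRing R hiding (zero)
  open PowerSeries R
  open Mult +-commutativeMonoid using (×-distrib-+) renaming (_×_ to _·_)
  open SemiringMult semiring using (×-comm-*)
  open Exp commutativeSemiring using (_^_)
  open SemiringSolver commutativeSemiring using (solve; con; _:+_; _:*_; _:=_)
  open SetoidReasoning setoid

  -- The sum unfolds at its first term, so `(f ⊛ g) (suc n)` is by definition
  -- `f 0 * g (suc n) + (shift f ⊛ g) n`. The inductions on products rest on this: they lower the
  -- degree and shift the left factor.
  shift : Series → Series
  shift f n = f (suc n)

  ⊛-cong : ∀ {f f′ g g′} → f ≋ f′ → g ≋ g′ → f ⊛ g ≋ f′ ⊛ g′
  ⊛-cong p q zero    = +-congʳ (*-cong (p 0) (q 0))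
  ⊛-cong p q (suc n) = +-cong (*-cong (p 0) (q (suc n))) (⊛-cong (λ k → p (suc k)) q n)

  ⊛-congʳ : ∀ h {f g} → f ≋ g → f ⊛ h ≋ g ⊛ h
  ⊛-congʳ h p = ⊛-cong {g = h} p (λ _ → refl)

  ⊛-congˡ : ∀ h {f g} → f ≋ g → h ⊛ f ≋ h ⊛ g
  ⊛-congˡ h p = ⊛-cong {h} (λ _ → refl) p

  ⊛-distribʳ : ∀ h f g → (f ⊕ g) ⊛ h ≋ (f ⊛ h) ⊕ (g ⊛ h)
  ⊛-distribʳ h f g zero =
    trans (+-congʳ (distribʳ _ _ _))
      (solve 2 (λ a b → (a :+ b) :+ con 0 := (a :+ con 0) :+ (b :+ con 0)) refl _ _)
  ⊛-distribʳ h f g (suc n) = trans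
    (+-congˡ (⊛-distribʳ h (shift f) (shift g) n))
    (solve 5 (λ a b c u v → (a :+ b) :* c :+ (u :+ v) := (a :* c :+ u) :+ (b :* c :+ v))
      refl (f 0) (g 0) (h (suc n)) ((shift f ⊛ h) n) ((shift g ⊛ h) n))

  •-⊛-assoc : ∀ a f g → (a • f) ⊛ g ≋ a • (f ⊛ g)
  •-⊛-assoc a f g zero =
    solve 3 (λ a b c → (a :* b) :* c :+ con 0 := a :* (b :* c :+ con 0)) refl a (f 0) (g 0)
  •-⊛-assoc a f g (suc n) = trans
    (+-congˡ (•-⊛-assoc a (shift f) g n))
    (solve 4 (λ a b c u → (a :* b) :* c :+ a :* u := a :* (b :* c :+ u))
      refl a (f 0) (g (suc n)) ((shift f ⊛ g) n))

  ⊛-assoc : ∀ f g h → (f ⊛ g) ⊛ h ≋ f ⊛ (g ⊛ h)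
  ⊛-assoc f g h zero =
    solve 3 (λ a b c → (a :* b :+ con 0) :* c :+ con 0 := a :* (b :* c :+ con 0) :+ con 0)
      refl (f 0) (g 0) (h 0)
  ⊛-assoc f g h (suc n) = begin
    -- By definition, `shift (f ⊛ g)` is `(f 0 • shift g) ⊕ (shift f ⊛ g)`.
    (f 0 * g 0 + 0#) * h (suc n) + (((f 0 • shift g) ⊕ (shift f ⊛ g)) ⊛ h) n
      ≈⟨ +-cong (*-congʳ (+-identityʳ _)) (⊛-distribʳ h (f 0 • shift g) (shift f ⊛ g) n) ⟩
    f 0 * g 0 * h (suc n) + (((f 0 • shift g) ⊛ h) n + ((shift f ⊛ g) ⊛ h) n)
      ≈⟨ +-congˡ (+-cong (•-⊛-assoc (f 0) (shift g) h n) (⊛-assoc (shift f) g h n)) ⟩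
    f 0 * g 0 * h (suc n) + (f 0 * (shift g ⊛ h) n + (shift f ⊛ (g ⊛ h)) n)
      ≈⟨ solve 5 (λ a b c u v → a :* b :* c :+ (a :* u :+ v) := a :* (b :* c :+ u) :+ v)
           refl (f 0) (g 0) (h (suc n)) ((shift g ⊛ h) n) ((shift f ⊛ (g ⊛ h)) n) ⟩
    f 0 * (g ⊛ h) (suc n) + (shift f ⊛ (g ⊛ h)) n ∎

  -- Splits off the last term instead of the first. Commutativity needs this because swapping the
  -- factors reverses the order of the terms.
  ⊛-sucʳ : ∀ f g n → (f ⊛ g) (suc n) ≈ (f ⊛ shift g) n + f (suc n) * g 0
  ⊛-sucʳ f g zero =
    trans (+-congˡ (+-identityʳ _)) (+-congʳ (sym (+-identityʳ _)))
  ⊛-sucʳ f g (suc n) = trans (+-congˡ (⊛-sucʳ (shift f) g n)) (sym (+-assoc _ _ _))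

  ⊛-comm : ∀ f g → f ⊛ g ≋ g ⊛ f
  ⊛-comm f g zero    = +-congʳ (*-comm (f 0) (g 0))
  ⊛-comm f g (suc n) = begin
    f 0 * g (suc n) + (shift f ⊛ g) n   ≈⟨ +-cong (*-comm _ _) (⊛-comm (shift f) g n) ⟩
    g (suc n) * f 0 + (g ⊛ shift f) n   ≈⟨ +-comm _ _ ⟩
    (g ⊛ shift f) n + g (suc n) * f 0   ≈⟨ ⊛-sucʳ g f n ⟨
    (g ⊛ f) (suc n) ∎

  ⊛-zeroˡ : ∀ f → (λ _ → 0#) ⊛ f ≋ λ _ → 0#
  ⊛-zeroˡ f zero    = trans (+-congʳ (zeroˡ _)) (+-identityʳ _)
  ⊛-zeroˡ f (suc n) = trans (+-cong (zeroˡ _) (⊛-zeroˡ f n)) (+-identityʳ _)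

  ⊛-identityˡ : ∀ f → 1ˢ ⊛ f ≋ f
  ⊛-identityˡ f zero    = trans (+-identityʳ _) (*-identityˡ _)
  ⊛-identityˡ f (suc n) = trans (+-cong (*-identityˡ _) (⊛-zeroˡ f n)) (+-identityʳ _)

  -- The bundle makes the semiring solver and general ring identities available for whole series.
  seriesRing : CommutativeRing c ℓ
  seriesRing = record
    { Carrier = Series ; _≈_ = _≋_ ; _+_ = _⊕_ ; _*_ = _⊛_ ; -_ = λ f n → - f n
    ; 0# = λ _ → 0# ; 1# = 1ˢ
    ; isCommutativeRing = record
      { isRing = record
        { +-isAbelianGroup = +ˢ-isAbelianGroup
        ; *-cong     = ⊛-cong
        ; *-assoc    = ⊛-assoc
        ; *-identity = comm∧idˡ⇒id ⊛-comm ⊛-identityˡ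
        ; distrib    = comm∧distrʳ⇒distr ⊕-cong ⊛-comm ⊛-distribʳ
        }
      ; *-comm = ⊛-comm
      }
    }
    where
    open Pointwise ℕ using (isAbelianGroup)
    +ˢ-isAbelianGroup = isAbelianGroup +-isAbelianGroup
    open Consequences (IsAbelianGroup.setoid +ˢ-isAbelianGroup) using (comm∧idˡ⇒id; comm∧distrʳ⇒distr)
    ⊕-cong : ∀ {f f′ g g′} → f ≋ f′ → g ≋ g′ → f ⊕ g ≋ f′ ⊕ g′
    ⊕-cong p q n = +-cong (p n) (q n)

  -- Multiplication by t and the substitution of a t for t.

  X-⊛ : ∀ f n → (X ⊛ f) (suc n) ≈ f n
  X-⊛ f n = trans (+-cong (zeroˡ _) (⊛-identityˡ f n)) (+-identityˡ _)

  1+X-⊛ : ∀ f n → ((1ˢ ⊕ X) ⊛ f) (suc n) ≈ f (suc n) + f n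
  1+X-⊛ f n = trans (⊛-distribʳ f 1ˢ X (suc n)) (+-cong (⊛-identityˡ f (suc n)) (X-⊛ f n))

  X-⊛-cancel : ∀ {f g} → X ⊛ f ≋ X ⊛ g → f ≋ g
  X-⊛-cancel {f} {g} p n = trans (sym (X-⊛ f n)) (trans (p (suc n)) (X-⊛ g n))

  dilate-cong : ∀ a {f g} → f ≋ g → dilate a f ≋ dilate a g
  dilate-cong a p n = *-congʳ (p n)

  -- The inductive step moves one factor `a` across the shift: `shift (dilate a f)` agrees with
  -- `a • dilate a (shift f)`.
  dilate-⊛ : ∀ a f g → dilate a (f ⊛ g) ≋ dilate a f ⊛ dilate a g
  dilate-⊛ a f g zero =
    solve 2 (λ b c → (b :* c :+ con 0) :* con 1 := b :* con 1 :* (c :* con 1) :+ con 0) refl (f 0) (g 0)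
  dilate-⊛ a f g (suc n) = begin
    (f 0 * g (suc n) + (shift f ⊛ g) n) * (a * a ^ n)
      ≈⟨ solve 5 (λ a b c u p → (b :* c :+ u) :* (a :* p) := b :* (c :* (a :* p)) :+ a :* (u :* p))
           refl a (f 0) (g (suc n)) ((shift f ⊛ g) n) (a ^ n) ⟩
    f 0 * dilate a g (suc n) + a * dilate a (shift f ⊛ g) n
      ≈⟨ +-cong (*-congʳ (sym (*-identityʳ _))) (*-congˡ (dilate-⊛ a (shift f) g n)) ⟩
    dilate a f 0 * dilate a g (suc n) + a * (dilate a (shift f) ⊛ dilate a g) n
      ≈⟨ +-congˡ (sym (•-⊛-assoc a (dilate a (shift f)) (dilate a g) n)) ⟩
    dilate a f 0 * dilate a g (suc n) + ((a • dilate a (shift f)) ⊛ dilate a g) n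
      ≈⟨ +-congˡ (⊛-congʳ (dilate a g) (λ k →
           solve 3 (λ a b p → a :* (b :* p) := b :* (a :* p)) refl a (f (suc k)) (a ^ k)) n) ⟩
    dilate a f 0 * dilate a g (suc n) + (shift (dilate a f) ⊛ dilate a g) n ∎

  -- The Euler derivation and the differential equation of the binomial series.

  -- t · d/dt
  θ : Series → Series
  θ f n = n · f n

  θ-⊛ : ∀ f g → θ (f ⊛ g) ≋ (θ f ⊛ g) ⊕ (f ⊛ θ g)
  θ-⊛ f g zero =
    solve 2 (λ a b → con 0 := (con 0 :* b :+ con 0) :+ (a :* con 0 :+ con 0)) refl (f 0) (g 0)
  θ-⊛ f g (suc n) = begin
    suc n · (f 0 * g (suc n) + U)
      ≈⟨ ×-distrib-+ _ _ (suc n) ⟩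
    suc n · (f 0 * g (suc n)) + (U + n · U)
      ≈⟨ +-cong (sym (×-comm-* (suc n) (f 0) (g (suc n)))) (+-congˡ (θ-⊛ (shift f) g n)) ⟩
    f 0 * θ g (suc n) + (U + ((θ (shift f) ⊛ g) n + (shift f ⊛ θ g) n))
      -- The spare copy of `U` is absorbed because `shift (θ f)` is `shift f ⊕ θ (shift f)`; the
      -- term `0# * g (suc n)` is the leading term of `θ f ⊛ g`.
      ≈⟨ solve 5 (λ u a b c g → a :+ (u :+ (b :+ c)) := (con 0 :* g :+ (u :+ b)) :+ (a :+ c)) refl
           U (f 0 * θ g (suc n)) ((θ (shift f) ⊛ g) n) ((shift f ⊛ θ g) n) (g (suc n)) ⟩
    (0# * g (suc n) + (U + (θ (shift f) ⊛ g) n)) + (f ⊛ θ g) (suc n)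
      ≈⟨ +-congʳ (+-congˡ (⊛-distribʳ g (shift f) (θ (shift f)) n)) ⟨
    (θ f ⊛ g) (suc n) + (f ⊛ θ g) (suc n) ∎
    where
    U = (shift f ⊛ g) n

  -- The differential equation (1 + t) f′ = z f of (1 + t)ᶻ, multiplied by t.
  BinomialODE : Carrier → Series → Set ℓ
  BinomialODE z f = (1ˢ ⊕ X) ⊛ θ f ≋ z • (X ⊛ f)

  -- By the Leibniz rule logarithmic derivatives add under multiplication, and so do the exponents.
  BinomialODE-⊛ : ∀ {z w f g} → BinomialODE z f → BinomialODE w g → BinomialODE (z + w) (f ⊛ g)
  BinomialODE-⊛ {z} {w} {f} {g} p q n = begin
    ((1ˢ ⊕ X) ⊛ θ (f ⊛ g)) n
      ≈⟨ ⊛-congˡ (1ˢ ⊕ X) (θ-⊛ f g) n ⟩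
    ((1ˢ ⊕ X) ⊛ ((θ f ⊛ g) ⊕ (f ⊛ θ g))) n
      ≈⟨ S.solve 5 (λ u f g f′ g′ → u S.:* (f′ S.:* g S.:+ f S.:* g′)
           S.:= (u S.:* f′) S.:* g S.:+ (u S.:* g′) S.:* f) (λ _ → refl) (1ˢ ⊕ X) f g (θ f) (θ g) n ⟩
    (((1ˢ ⊕ X) ⊛ θ f) ⊛ g) n + (((1ˢ ⊕ X) ⊛ θ g) ⊛ f) n
      ≈⟨ +-cong (⊛-congʳ g p n) (⊛-congʳ f q n) ⟩
    ((z • (X ⊛ f)) ⊛ g) n + ((w • (X ⊛ g)) ⊛ f) n
      ≈⟨ +-cong (•-⊛-assoc z (X ⊛ f) g n) (•-⊛-assoc w (X ⊛ g) f n) ⟩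
    z * ((X ⊛ f) ⊛ g) n + w * ((X ⊛ g) ⊛ f) n
      ≈⟨ +-cong (*-congˡ (⊛-assoc X f g n)) (*-congˡ (S.solve 3 (λ x f g → x S.:* g S.:* f S.:= x S.:* (f S.:* g))
           (λ _ → refl) X f g n)) ⟩
    z * (X ⊛ (f ⊛ g)) n + w * (X ⊛ (f ⊛ g)) n
      ≈⟨ distribʳ _ z w ⟨
    (z + w) * (X ⊛ (f ⊛ g)) n ∎
    where module S = SemiringSolver (CommutativeRing.commutativeSemiring seriesRing)

  -- Substitution in special series, and uniqueness of the quotient t / f(t).

  dilate-1ˢ : ∀ a → dilate a 1ˢ ≋ 1ˢ
  dilate-1ˢ a zero    = *-identityʳ 1#
  dilate-1ˢ a (suc n) = zeroˡ _

  dilate-X : ∀ a → dilate a X ≋ a • X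
  dilate-X a zero          = trans (zeroˡ _) (sym (zeroʳ a))
  dilate-X a (suc zero)    = *-identityˡ _
  dilate-X a (suc (suc n)) = trans (zeroˡ _) (sym (zeroʳ a))

  dilate-⊖ : ∀ a f g → dilate a (f ⊖ g) ≋ dilate a f ⊖ dilate a g
  dilate-⊖ a f g n = trans (distribʳ _ _ _) (+-congˡ (sym (-‿distribˡ-* (g n) (a ^ n))))
    where open RingProperties ring using (-‿distribˡ-*)

  -- The quotient `q` with `f ⊛ q ≋ X` takes the place of an inverse of `f`: multiplying the
  -- hypothesis by `q` produces a factor `X` on both sides, and `X` cancels.
  X/-unique : ∀ f h {g k} → f ⊛ g ≋ X ⊛ k → g ≋ X/ f h ⊛ k
  X/-unique f h {g} {k} p = X-⊛-cancel λ n → begin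
    (X ⊛ g) n          ≈⟨ ⊛-congʳ g (X/-correct f h) n ⟨
    ((f ⊛ q) ⊛ g) n    ≈⟨ S.solve 3 (λ f q g → f S.:* q S.:* g S.:= q S.:* (f S.:* g)) (λ _ → refl) f q g n ⟩
    (q ⊛ (f ⊛ g)) n    ≈⟨ ⊛-congˡ q p n ⟩
    (q ⊛ (X ⊛ k)) n    ≈⟨ S.solve 3 (λ q t k → q S.:* (t S.:* k) S.:= t S.:* (q S.:* k)) (λ _ → refl) q X k n ⟩
    (X ⊛ (q ⊛ k)) n    ∎
    where
    module S = SemiringSolver (CommutativeRing.commutativeSemiring seriesRing)
    q = X/ f h

-- Sign identities in a commutative ring.

module _ {c ℓ} (R : CommutativeRing c ℓ) where
  open CommutativeRing R
  open RingProperties ring using (x[y-z]≈xy-xz; -‿distribˡ-*; -‿distribʳ-*; -‿involutive)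
  open AbelianGroupProperties +-abelianGroup using (⁻¹-anti-homo‿-)
  open SetoidReasoning setoid

  -- When `g` is inverse to `f`, the factor `f - 1#` equals `f * - (g - 1#)`. With f = e_λ(t), g its
  -- inverse and x = t, this is the algebra behind (-t) / (g - 1) = t f / (f - 1), stated without
  -- division.
  [f-1]b≈xf : ∀ f g b x → f * g ≈ 1# → (g - 1#) * b ≈ - x → (f - 1#) * b ≈ x * f
  [f-1]b≈xf f g b x fg≈1 p = begin
    (f - 1#) * b            ≈⟨ *-congʳ (+-cong (*-identityʳ f) (-‿cong fg≈1)) ⟨
    (f * 1# - f * g) * b    ≈⟨ *-congʳ (x[y-z]≈xy-xz f 1# g) ⟨
    f * (1# - g) * b        ≈⟨ *-congʳ (*-congˡ (⁻¹-anti-homo‿- g 1#)) ⟨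
    f * - (g - 1#) * b      ≈⟨ *-assoc _ _ _ ⟩
    f * (- (g - 1#) * b)    ≈⟨ *-congˡ (-‿distribˡ-* (g - 1#) b) ⟨
    f * - ((g - 1#) * b)    ≈⟨ *-congˡ (-‿cong p) ⟩
    f * - - x               ≈⟨ *-congˡ (-‿involutive x) ⟩
    f * x                   ≈⟨ *-comm f x ⟩
    x * f                   ∎

  -x*-y≈x*y : ∀ x y → - x * - y ≈ x * y
  -x*-y≈x*y x y = begin
    - x * - y      ≈⟨ -‿distribˡ-* x (- y) ⟨
    - (x * - y)    ≈⟨ -‿cong (-‿distribʳ-* x y) ⟨
    - - (x * y)    ≈⟨ -‿involutive (x * y) ⟩
    x * y          ∎

open import Defs

private
  module ℝᴿ = CommutativeRing ℝ-commutativeRing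
  module ℂᴿ = CommutativeRing ℂ-commutativeRing
open CauchyProduct ℂ-commutativeRing

open Mult ℂᴿ.+-commutativeMonoid using (×-congʳ) renaming (_×_ to _·_)
open SemiringMult ℂᴿ.semiring using (×-comm-*; ×-assoc-*; ×1-homo-*)
open Exp ℂᴿ.commutativeSemiring using (^-distrib-*; ^-congˡ)
open RingProperties ℂᴿ.ring using (-‿distribˡ-*; -‿distribʳ-*; -‿involutive; -1*x≈-x; [y-z]x≈yx-zx)
open SemiringSolver ℂᴿ.commutativeSemiring using (solve; con; _:+_; _:*_; _:=_)

-- Fractions of natural numbers and inverses of real numbers.

-- Normalised fractions with a variable entry do not compute. Identities between them are therefore
-- checked on unnormalised representatives by cross-multiplication and carried over along `fromℚᵘ`.
fromℚᵘ-homo-+ : ∀ p q → ℚ.fromℚᵘ (p ℚᵘ.+ q) ≡ ℚ.fromℚᵘ p ℚ.+ ℚ.fromℚᵘ q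
fromℚᵘ-homo-+ p q = ℚₚ.toℚᵘ-injective (ℚᵘₚ.≃-trans (ℚₚ.toℚᵘ-fromℚᵘ (p ℚᵘ.+ q)) (ℚᵘₚ.≃-sym
  (ℚᵘₚ.≃-trans (ℚₚ.toℚᵘ-homo-+ (ℚ.fromℚᵘ p) (ℚ.fromℚᵘ q))
    (ℚᵘₚ.+-cong (ℚₚ.toℚᵘ-fromℚᵘ p) (ℚₚ.toℚᵘ-fromℚᵘ q)))))

fromℚᵘ-homo-* : ∀ p q → ℚ.fromℚᵘ (p ℚᵘ.* q) ≡ ℚ.fromℚᵘ p ℚ.* ℚ.fromℚᵘ q
fromℚᵘ-homo-* p q = ℚₚ.toℚᵘ-injective (ℚᵘₚ.≃-trans (ℚₚ.toℚᵘ-fromℚᵘ (p ℚᵘ.* q)) (ℚᵘₚ.≃-sym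
  (ℚᵘₚ.≃-trans (ℚₚ.toℚᵘ-homo-* (ℚ.fromℚᵘ p) (ℚ.fromℚᵘ q))
    (ℚᵘₚ.*-cong (ℚₚ.toℚᵘ-fromℚᵘ p) (ℚₚ.toℚᵘ-fromℚᵘ q)))))

1+n/1 : ∀ n → (+ suc n) ℚ./ 1 ≡ ℚ.1ℚ ℚ.+ (+ n) ℚ./ 1
1+n/1 n = ≡.trans (ℚₚ.fromℚᵘ-cong {ℚᵘ.mkℚᵘ (+ suc n) 0} {ℚᵘ.1ℚᵘ ℚᵘ.+ ℚᵘ.mkℚᵘ (+ n) 0}
    (ℚᵘ.*≡* (≡.cong (ℤ._* + 1) (≡.cong (ℤ._+_ (+ 1)) (≡.sym (ℤₚ.*-identityʳ (+ n)))))))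
  (fromℚᵘ-homo-+ ℚᵘ.1ℚᵘ (ℚᵘ.mkℚᵘ (+ n) 0))

n*1/n : ∀ n .{{_ : ℕ.NonZero n}} → ((+ n) ℚ./ 1) ℚ.* ((+ 1) ℚ./ n) ≡ ℚ.1ℚ
n*1/n (suc n) = ≡.trans
  -- `mkℚᵘ` takes the denominator minus one, so these representatives are (n+1)/1 and 1/(n+1).
  (≡.sym (fromℚᵘ-homo-* (ℚᵘ.mkℚᵘ (+ suc n) 0) (ℚᵘ.mkℚᵘ (+ 1) n)))
  (ℚₚ.fromℚᵘ-cong {ℚᵘ.mkℚᵘ (+ suc n) 0 ℚᵘ.* ℚᵘ.mkℚᵘ (+ 1) n} {ℚᵘ.1ℚᵘ}
    (ℚᵘ.*≡* (≡.trans (ℤₚ.*-identityʳ _) (≡.trans (ℤₚ.*-comm (+ suc n) (+ 1)) (≡.cong (ℤ._*_ (+ 1)) (≡.cong (λ k → + suc k) (≡.sym (ℕₚ.+-identityʳ n))))))))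

-- Uniqueness of inverses: `u` and `-ᴿ v` both invert `-ᴿ x`. Only the inverse law is used, so any
-- apartness proof `k` will do.
⁻¹-neg : ∀ x (h : x # 0ℝ) (k : -ᴿ x # 0ℝ) → (-ᴿ x) ⁻¹[ k ] ≃ -ᴿ (x ⁻¹[ h ])
⁻¹-neg x h k = begin
  u                      ≈⟨ ℝᴿ.*-identityʳ u ⟨
  u *ᴿ 1ℝ                ≈⟨ ℝᴿ.*-congˡ (⁻¹-inverseˡ x h) ⟨
  u *ᴿ (v *ᴿ x)          ≈⟨ ℝᴿ.*-congˡ (-x*-y≈x*y ℝ-commutativeRing v x) ⟨
  u *ᴿ (-ᴿ v *ᴿ -ᴿ x)    ≈⟨ ℝᴿ.*-congˡ (ℝᴿ.*-comm _ _) ⟩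
  u *ᴿ (-ᴿ x *ᴿ -ᴿ v)    ≈⟨ ℝᴿ.*-assoc _ _ _ ⟨
  u *ᴿ -ᴿ x *ᴿ -ᴿ v      ≈⟨ ℝᴿ.*-congʳ (⁻¹-inverseˡ (-ᴿ x) k) ⟩
  1ℝ *ᴿ -ᴿ v             ≈⟨ ℝᴿ.*-identityˡ _ ⟩
  -ᴿ v                   ∎
  where
  open SetoidReasoning ℝᴿ.setoid
  u = (-ᴿ x) ⁻¹[ k ]
  v = x ⁻¹[ h ]

open SetoidReasoning ℂᴿ.setoid

-- Real and natural numbers inside the complex numbers.

fromℝ-cong : ∀ {x y} → x ≃ y → fromℝ x ≈ fromℝ y
fromℝ-cong p = p , ℝᴿ.refl

fromℝ-+ : ∀ x y → fromℝ (x +ᴿ y) ≈ fromℝ x +ᶜ fromℝ y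
fromℝ-+ x y = ℝᴿ.refl , ℝᴿ.sym (ℝᴿ.+-identityʳ 0ℝ)

fromℝ-neg : ∀ x → fromℝ (-ᴿ x) ≈ -ᶜ fromℝ x
fromℝ-neg x = ℝᴿ.refl , ℝᴿ.sym (RingProperties.-0#≈0# ℝᴿ.ring)

fromℝ-* : ∀ x y → fromℝ (x *ᴿ y) ≈ fromℝ x *ᶜ fromℝ y
fromℝ-* x y =
  ℝᴿ.sym (ℝᴿ.trans (ℝᴿ.+-congˡ (ℝᴿ.trans (ℝᴿ.-‿cong (ℝᴿ.zeroʳ 0ℝ)) (RingProperties.-0#≈0# ℝᴿ.ring)))
    (ℝᴿ.+-identityʳ _)) ,
  ℝᴿ.sym (ℝᴿ.trans (ℝᴿ.+-cong (ℝᴿ.zeroʳ x) (ℝᴿ.zeroˡ y)) (ℝᴿ.+-identityʳ 0ℝ))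

-- Links two forms of a natural number: `θ` multiplies by iterated addition, while falling
-- factorials use the embedding through the rationals.
ℕ→ℂ≈·1 : ∀ n → ℕ→ℂ n ≈ n · 1ℂ
ℕ→ℂ≈·1 zero    = ℂᴿ.refl
ℕ→ℂ≈·1 (suc n) = begin
  ratℂ ((+ suc n) ℚ./ 1)               ≡⟨ ≡.cong ratℂ (1+n/1 n) ⟩
  ratℂ (ℚ.1ℚ ℚ.+ (+ n) ℚ./ 1)          ≈⟨ fromℝ-cong (fromℚ-+ _ _) ⟩
  fromℝ (1ℝ +ᴿ fromℚ ((+ n) ℚ./ 1))    ≈⟨ fromℝ-+ _ _ ⟩
  1ℂ +ᶜ ℕ→ℂ n                         ≈⟨ ℂᴿ.+-congˡ {1ℂ} (ℕ→ℂ≈·1 n) ⟩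
  1ℂ +ᶜ n · 1ℂ                         ∎

·≈ℕ→ℂ* : ∀ n z → n · z ≈ ℕ→ℂ n *ᶜ z
·≈ℕ→ℂ* n z = begin
  n · z             ≈⟨ ×-congʳ n (ℂᴿ.*-identityˡ z) ⟨
  n · (1ℂ *ᶜ z)     ≈⟨ ×-assoc-* n 1ℂ z ⟨
  (n · 1ℂ) *ᶜ z     ≈⟨ ℂᴿ.*-congʳ {z} (ℕ→ℂ≈·1 n) ⟨
  ℕ→ℂ n *ᶜ z        ∎

ℕ→ℂ-* : ∀ m n → ℕ→ℂ (m ℕ.* n) ≈ ℕ→ℂ m *ᶜ ℕ→ℂ n
ℕ→ℂ-* m n = begin
  ℕ→ℂ (m ℕ.* n)            ≈⟨ ℕ→ℂ≈·1 (m ℕ.* n) ⟩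
  (m ℕ.* n) · 1ℂ            ≈⟨ ×1-homo-* m n ⟩
  (m · 1ℂ) *ᶜ (n · 1ℂ)      ≈⟨ ℂᴿ.*-cong (ℕ→ℂ≈·1 m) (ℕ→ℂ≈·1 n) ⟨
  ℕ→ℂ m *ᶜ ℕ→ℂ n           ∎

ℕ→ℂ-inverseʳ : ∀ n .{{_ : ℕ.NonZero n}} → ℕ→ℂ n *ᶜ ratℂ ((+ 1) ℚ./ n) ≈ 1ℂ
ℕ→ℂ-inverseʳ n = begin
  ℕ→ℂ n *ᶜ ratℂ ((+ 1) ℚ./ n)                        ≈⟨ fromℝ-* _ _ ⟨
  fromℝ (fromℚ ((+ n) ℚ./ 1) *ᴿ fromℚ ((+ 1) ℚ./ n)) ≈⟨ fromℝ-cong (fromℚ-* _ _) ⟨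
  ratℂ (((+ n) ℚ./ 1) ℚ.* ((+ 1) ℚ./ n))             ≡⟨ ≡.cong ratℂ (n*1/n n) ⟩
  1ℂ                                                 ∎

-- Characteristic zero: multiplication by `suc n` is undone by the rational 1/(n+1). This allows the
-- recursion from the differential equation to be solved for the next coefficient.
·-suc-cancel : ∀ n {z w} → suc n · z ≈ suc n · w → z ≈ w
·-suc-cancel n {z} {w} p = begin
  z                         ≈⟨ unit z ⟩
  u *ᶜ (suc n · z)          ≈⟨ ℂᴿ.*-congˡ {u} p ⟩
  u *ᶜ (suc n · w)          ≈⟨ unit w ⟨
  w                         ∎
  where
  u = ratℂ ((+ 1) ℚ./ suc n)
  unit : ∀ v → v ≈ u *ᶜ (suc n · v)
  unit v = begin
    v                            ≈⟨ ℂᴿ.*-identityˡ v ⟨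
    1ℂ *ᶜ v                      ≈⟨ ℂᴿ.*-congʳ {v} (ℂᴿ.trans (ℂᴿ.*-comm u (ℕ→ℂ (suc n))) (ℕ→ℂ-inverseʳ (suc n))) ⟨
    (u *ᶜ ℕ→ℂ (suc n)) *ᶜ v      ≈⟨ ℂᴿ.*-assoc u (ℕ→ℂ (suc n)) v ⟩
    u *ᶜ (ℕ→ℂ (suc n) *ᶜ v)      ≈⟨ ℂᴿ.*-congˡ {u} (·≈ℕ→ℂ* (suc n) v) ⟨
    u *ᶜ (suc n · v)             ∎

1/!-suc : ∀ n → suc n · (1/! suc n) ≈ 1/! n
1/!-suc n = begin
  suc n · r′                        ≈⟨ ·≈ℕ→ℂ* (suc n) r′ ⟩
  N *ᶜ r′                           ≈⟨ ℂᴿ.*-identityʳ _ ⟨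
  -- Inserting 1 = n! · 1/n! brings `N` and `M` together as (n+1)!, which cancels `r′`.
  N *ᶜ r′ *ᶜ 1ℂ                     ≈⟨ ℂᴿ.*-congˡ {N *ᶜ r′} (ℕ→ℂ-inverseʳ (n !) {{ℕₚ._!≢0 n}}) ⟨
  N *ᶜ r′ *ᶜ (M *ᶜ r)               ≈⟨ solve 4 (λ N r′ M r → N :* r′ :* (M :* r) := N :* M :* r′ :* r) ℂᴿ.refl N r′ M r ⟩
  N *ᶜ M *ᶜ r′ *ᶜ r                 ≈⟨ ℂᴿ.*-congʳ {r} (ℂᴿ.*-congʳ {r′} (ℕ→ℂ-* (suc n) (n !))) ⟨
  ℕ→ℂ (suc n !) *ᶜ r′ *ᶜ r          ≈⟨ ℂᴿ.*-congʳ {r} (ℕ→ℂ-inverseʳ (suc n !) {{ℕₚ._!≢0 (suc n)}}) ⟩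
  1ℂ *ᶜ r                           ≈⟨ ℂᴿ.*-identityˡ r ⟩
  r                                 ∎
  where
  N = ℕ→ℂ (suc n)
  M = ℕ→ℂ (n !)
  r = 1/! n
  r′ = 1/! suc n

-- The binomial series and its addition law.

-- Comparing coefficients of degree n+1 turns the differential equation into a recursion that yields
-- each coefficient from the preceding one.
BinomialODE-coeff : ∀ z f n → BinomialODE z f → suc n · f (suc n) +ᶜ n · f n ≈ z *ᶜ f n
BinomialODE-coeff z f n p = begin
  θ f (suc n) +ᶜ θ f n                 ≈⟨ 1+X-⊛ (θ f) n ⟨
  ((1ˢ ⊕ X) ⊛ θ f) (suc n)             ≈⟨ p (suc n) ⟩
  z *ᶜ (X ⊛ f) (suc n)                 ≈⟨ ℂᴿ.*-congˡ {z} (X-⊛ f n) ⟩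
  z *ᶜ f n                             ∎

BinomialODE-unique : ∀ z f g → BinomialODE z f → BinomialODE z g → f 0 ≈ g 0 → f ≋ g
BinomialODE-unique z f g p q eq zero    = eq
BinomialODE-unique z f g p q eq (suc n) = ·-suc-cancel n (+-cancelʳ (n · f n) _ _ (begin
  suc n · f (suc n) +ᶜ n · f n         ≈⟨ BinomialODE-coeff z f n p ⟩
  z *ᶜ f n                             ≈⟨ ℂᴿ.*-congˡ {z} ih ⟩
  z *ᶜ g n                             ≈⟨ BinomialODE-coeff z g n q ⟨
  suc n · g (suc n) +ᶜ n · g n         ≈⟨ ℂᴿ.+-congˡ {suc n · g (suc n)} (×-congʳ n ih) ⟨
  suc n · g (suc n) +ᶜ n · f n         ∎))
  where
  open RingProperties ℂᴿ.ring using (+-cancelʳ)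
  ih = BinomialODE-unique z f g p q eq n

binomialSeries-suc : ∀ z n →
  suc n · binomialSeries z (suc n) ≈ (z -ᶜ ℕ→ℂ n) *ᶜ binomialSeries z n
binomialSeries-suc z n = begin
  suc n · (F *ᶜ D *ᶜ (1/! suc n))     ≈⟨ ×-comm-* (suc n) (F *ᶜ D) (1/! suc n) ⟨
  F *ᶜ D *ᶜ (suc n · (1/! suc n))     ≈⟨ ℂᴿ.*-congˡ {F *ᶜ D} (1/!-suc n) ⟩
  F *ᶜ D *ᶜ (1/! n)                   ≈⟨ solve 3 (λ F D r → F :* D :* r := D :* (F :* r)) ℂᴿ.refl F D (1/! n) ⟩
  D *ᶜ (F *ᶜ (1/! n))                 ∎
  where
  F = falling z n
  D = z -ᶜ ℕ→ℂ n

-- In degree n+1 the last factor of the falling factorial gives (n+1) bₙ₊₁ = (z - n) bₙ, and adding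
-- n bₙ leaves z bₙ.
binomialSeries-ODE : ∀ z → BinomialODE z (binomialSeries z)
binomialSeries-ODE z zero =
  solve 2 (λ b z → (con 1 :+ con 0) :* con 0 :+ con 0 := z :* (con 0 :* b :+ con 0)) ℂᴿ.refl (binomialSeries z 0) z
binomialSeries-ODE z (suc n) = begin
  ((1ˢ ⊕ X) ⊛ θ b) (suc n)                             ≈⟨ 1+X-⊛ (θ b) n ⟩
  suc n · b (suc n) +ᶜ n · b n                         ≈⟨ ℂᴿ.+-cong (binomialSeries-suc z n) (·≈ℕ→ℂ* n (b n)) ⟩
  (z -ᶜ ℕ→ℂ n) *ᶜ b n +ᶜ ℕ→ℂ n *ᶜ b n                 ≈⟨ ℂᴿ.distribʳ (b n) (z -ᶜ ℕ→ℂ n) (ℕ→ℂ n) ⟨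
  (z -ᶜ ℕ→ℂ n +ᶜ ℕ→ℂ n) *ᶜ b n                        ≈⟨ ℂᴿ.*-congʳ {b n} (//-rightDividesˡ (ℕ→ℂ n) z) ⟩
  z *ᶜ b n                                             ≈⟨ ℂᴿ.*-congˡ {z} (X-⊛ b n) ⟨
  z *ᶜ (X ⊛ b) (suc n)                                 ∎
  where
  open AbelianGroupProperties ℂᴿ.+-abelianGroup using (//-rightDividesˡ)
  b = binomialSeries z

-- Coefficientwise this is the Chu-Vandermonde identity. It follows from uniqueness, as both
-- constant terms are 1.
binomialSeries-+ : ∀ z w → binomialSeries z ⊛ binomialSeries w ≋ binomialSeries (z +ᶜ w)
binomialSeries-+ z w = BinomialODE-unique (z +ᶜ w) _ _
  (BinomialODE-⊛ {z} {w} (binomialSeries-ODE z) (binomialSeries-ODE w))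
  (binomialSeries-ODE (z +ᶜ w))
  (solve 0 ((con 1 :* con 1) :* (con 1 :* con 1) :+ con 0 := con 1 :* con 1) ℂᴿ.refl)

binomialSeries-cong : ∀ {z w} → z ≈ w → binomialSeries z ≋ binomialSeries w
binomialSeries-cong {z} {w} p n = ℂᴿ.*-congʳ {1/! n} (falling-cong n)
  where
  falling-cong : ∀ n → falling z n ≈ falling w n
  falling-cong zero    = ℂᴿ.refl
  falling-cong (suc n) = ℂᴿ.*-cong (falling-cong n) (ℂᴿ.+-congʳ { -ᶜ ℕ→ℂ n} p)

binomialSeries-0 : binomialSeries 0ℂ ≋ 1ˢ
binomialSeries-0 zero    = ℂᴿ.*-identityˡ 1ℂ
binomialSeries-0 (suc n) = ℂᴿ.trans (ℂᴿ.*-congʳ {1/! suc n} (falling-0 n)) (ℂᴿ.zeroˡ (1/! suc n))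
  where
  falling-0 : ∀ n → falling 0ℂ (suc n) ≈ 0ℂ
  falling-0 zero    = ℂᴿ.trans (ℂᴿ.*-identityˡ _) (ℂᴿ.-‿inverseʳ 0ℂ)
  falling-0 (suc n) = ℂᴿ.trans (ℂᴿ.*-congʳ {0ℂ -ᶜ ℕ→ℂ (suc n)} (falling-0 n)) (ℂᴿ.zeroˡ _)


-- The degenerate exponential.

e-cong : ∀ lam h {z w} → z ≈ w → e lam h z ≋ e lam h w
e-cong lam h p = dilate-cong (fromℝ lam) (binomialSeries-cong (ℂᴿ.*-congʳ {fromℝ (lam ⁻¹[ h ])} p))

e-+ : ∀ lam h z w → e lam h z ⊛ e lam h w ≋ e lam h (z +ᶜ w)
e-+ lam h z w n = begin
  (e lam h z ⊛ e lam h w) n                        ≈⟨ dilate-⊛ l (binomialSeries (z *ᶜ u)) (binomialSeries (w *ᶜ u)) n ⟨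
  dilate l (binomialSeries (z *ᶜ u) ⊛ binomialSeries (w *ᶜ u)) n
    ≈⟨ dilate-cong l (binomialSeries-+ (z *ᶜ u) (w *ᶜ u)) n ⟩
  dilate l (binomialSeries (z *ᶜ u +ᶜ w *ᶜ u)) n   ≈⟨ dilate-cong l (binomialSeries-cong (ℂᴿ.distribʳ u z w)) n ⟨
  e lam h (z +ᶜ w) n                               ∎
  where
  l = fromℝ lam
  u = fromℝ (lam ⁻¹[ h ])

e-0 : ∀ lam h → e lam h 0ℂ ≋ 1ˢ
e-0 lam h n = begin
  e lam h 0ℂ n                           ≈⟨ dilate-cong l (binomialSeries-cong (ℂᴿ.zeroˡ (fromℝ (lam ⁻¹[ h ])))) n ⟩
  dilate l (binomialSeries 0ℂ) n         ≈⟨ dilate-cong l binomialSeries-0 n ⟩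
  dilate l 1ˢ n                          ≈⟨ dilate-1ˢ l n ⟩
  1ˢ n                                   ∎
  where l = fromℝ lam

-- `base` expresses the invariance of λt, and `exponent` the sign change of z/λ.
e-reflect : ∀ lam h z → dilate (-ᶜ 1ℂ) (e (-ᴿ lam) (-‿#0 h) z) ≋ e lam h (-ᶜ z)
e-reflect lam h z n = begin
  binomialSeries (z *ᶜ fromℝ u′) n *ᶜ (fromℝ (-ᴿ lam) ^ n) *ᶜ ((-ᶜ 1ℂ) ^ n)
    ≈⟨ ℂᴿ.*-assoc (binomialSeries (z *ᶜ fromℝ u′) n) _ _ ⟩
  binomialSeries (z *ᶜ fromℝ u′) n *ᶜ ((fromℝ (-ᴿ lam) ^ n) *ᶜ ((-ᶜ 1ℂ) ^ n))
    ≈⟨ ℂᴿ.*-cong (binomialSeries-cong exponent n) (ℂᴿ.sym (^-distrib-* (fromℝ (-ᴿ lam)) (-ᶜ 1ℂ) n)) ⟩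
  binomialSeries (-ᶜ z *ᶜ fromℝ u) n *ᶜ ((fromℝ (-ᴿ lam) *ᶜ -ᶜ 1ℂ) ^ n)
    ≈⟨ ℂᴿ.*-congˡ {binomialSeries (-ᶜ z *ᶜ fromℝ u) n} (^-congˡ n base) ⟩
  binomialSeries (-ᶜ z *ᶜ fromℝ u) n *ᶜ (fromℝ lam ^ n) ∎
  where
  u = lam ⁻¹[ h ]
  u′ = (-ᴿ lam) ⁻¹[ -‿#0 h ]
  base : fromℝ (-ᴿ lam) *ᶜ -ᶜ 1ℂ ≈ fromℝ lam
  base = begin
    fromℝ (-ᴿ lam) *ᶜ -ᶜ 1ℂ      ≈⟨ ℂᴿ.*-congʳ { -ᶜ 1ℂ} (fromℝ-neg lam) ⟩
    -ᶜ fromℝ lam *ᶜ -ᶜ 1ℂ        ≈⟨ -x*-y≈x*y ℂ-commutativeRing (fromℝ lam) 1ℂ ⟩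
    fromℝ lam *ᶜ 1ℂ              ≈⟨ ℂᴿ.*-identityʳ (fromℝ lam) ⟩
    fromℝ lam                    ∎
  exponent : z *ᶜ fromℝ u′ ≈ -ᶜ z *ᶜ fromℝ u
  exponent = begin
    z *ᶜ fromℝ u′                ≈⟨ ℂᴿ.*-congˡ {z} (fromℝ-cong (⁻¹-neg lam h (-‿#0 h))) ⟩
    z *ᶜ fromℝ (-ᴿ u)            ≈⟨ ℂᴿ.*-congˡ {z} (fromℝ-neg u) ⟩
    z *ᶜ -ᶜ fromℝ u              ≈⟨ -‿distribʳ-* z (fromℝ u) ⟨
    -ᶜ (z *ᶜ fromℝ u)            ≈⟨ -‿distribˡ-* z (fromℝ u) ⟩
    -ᶜ z *ᶜ fromℝ u              ∎

-- Reflection of the factors of the generating functions.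

-- Substituting -t in the defining equation of `q` gives (e_λ⁻¹(t) - 1) q(-t) = -t. Multiplying by
-- -e_λ(t) gives (e_λ(t) - 1) q(-t) = t e_λ(t), and `X/-unique` then identifies q(-t).
t/[e-1]-reflect : ∀ lam h →
  dilate (-ᶜ 1ℂ) (t/[e-1] (-ᴿ lam) (-‿#0 h)) ≋ t/[e-1] lam h ⊛ e lam h 1ℂ
t/[e-1]-reflect lam h = X/-unique (e-1 lam h) (e-1-simpleZero lam h)
  ([f-1]b≈xf seriesRing (e lam h 1ℂ) (e lam h (-ᶜ 1ℂ)) (dilate (-ᶜ 1ℂ) q) X e⊛e⁻¹ [e⁻¹-1]⊛q)
  where
  q = t/[e-1] (-ᴿ lam) (-‿#0 h)
  e⊛e⁻¹ : e lam h 1ℂ ⊛ e lam h (-ᶜ 1ℂ) ≋ 1ˢ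
  e⊛e⁻¹ n = begin
    (e lam h 1ℂ ⊛ e lam h (-ᶜ 1ℂ)) n     ≈⟨ e-+ lam h 1ℂ (-ᶜ 1ℂ) n ⟩
    e lam h (1ℂ +ᶜ -ᶜ 1ℂ) n              ≈⟨ e-cong lam h (ℂᴿ.-‿inverseʳ 1ℂ) n ⟩
    e lam h 0ℂ n                         ≈⟨ e-0 lam h n ⟩
    1ˢ n                                 ∎
  scaled : dilate (-ᶜ 1ℂ) (e-1 (-ᴿ lam) (-‿#0 h)) ≋ e lam h (-ᶜ 1ℂ) ⊖ 1ˢ
  scaled n = ℂᴿ.trans (dilate-⊖ (-ᶜ 1ℂ) (e (-ᴿ lam) (-‿#0 h) 1ℂ) 1ˢ n)
    (ℂᴿ.+-cong (e-reflect lam h 1ℂ n) (ℂᴿ.-‿cong (dilate-1ˢ (-ᶜ 1ℂ) n)))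
  [e⁻¹-1]⊛q : (e lam h (-ᶜ 1ℂ) ⊖ 1ˢ) ⊛ dilate (-ᶜ 1ℂ) q ≋ λ n → -ᶜ X n
  [e⁻¹-1]⊛q n = begin
    ((e lam h (-ᶜ 1ℂ) ⊖ 1ˢ) ⊛ dilate (-ᶜ 1ℂ) q) n
      ≈⟨ ⊛-congʳ (dilate (-ᶜ 1ℂ) q) scaled n ⟨
    (dilate (-ᶜ 1ℂ) (e-1 (-ᴿ lam) (-‿#0 h)) ⊛ dilate (-ᶜ 1ℂ) q) n
      ≈⟨ dilate-⊛ (-ᶜ 1ℂ) (e-1 (-ᴿ lam) (-‿#0 h)) q n ⟨
    dilate (-ᶜ 1ℂ) (e-1 (-ᴿ lam) (-‿#0 h) ⊛ q) n
      ≈⟨ dilate-cong (-ᶜ 1ℂ) (X/-correct (e-1 (-ᴿ lam) (-‿#0 h)) (e-1-simpleZero (-ᴿ lam) (-‿#0 h))) n ⟩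
    dilate (-ᶜ 1ℂ) X n      ≈⟨ dilate-X (-ᶜ 1ℂ) n ⟩
    -ᶜ 1ℂ *ᶜ X n            ≈⟨ -1*x≈-x (X n) ⟩
    -ᶜ X n                  ∎

-- Reflection exchanges the exponentials at iy and -iy, and their sum is symmetric.
cosˢ-reflect : ∀ lam h y → cosˢ lam h y ≋ dilate (-ᶜ 1ℂ) (cosˢ (-ᴿ lam) (-‿#0 h) y)
cosˢ-reflect lam h y n = begin
  ½ *ᶜ (e lam h iy n +ᶜ e lam h (-ᶜ iy) n)
    -- Writing iy as -(-iy) gives both exponentials the form produced by `e-reflect`.
    ≈⟨ ℂᴿ.*-congˡ {½} (ℂᴿ.+-cong (e-cong lam h (-‿involutive iy) n) ℂᴿ.refl) ⟨
  ½ *ᶜ (e lam h (-ᶜ -ᶜ iy) n +ᶜ e lam h (-ᶜ iy) n)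
    ≈⟨ ℂᴿ.*-congˡ {½} (ℂᴿ.+-cong (e-reflect lam h (-ᶜ iy) n) (e-reflect lam h iy n)) ⟨
  ½ *ᶜ (B *ᶜ p +ᶜ A *ᶜ p)
    ≈⟨ solve 4 (λ c A B p → c :* (B :* p :+ A :* p) := c :* (A :+ B) :* p) ℂᴿ.refl ½ A B p ⟩
  ½ *ᶜ (A +ᶜ B) *ᶜ p ∎
  where
  ½ = ratℂ ℚ.½
  iy = 𝕚 *ᶜ fromℝ y
  p = (-ᶜ 1ℂ) ^ n
  A = e (-ᴿ lam) (-‿#0 h) iy n
  B = e (-ᴿ lam) (-‿#0 h) (-ᶜ iy) n

-- The same exchange reverses the difference of the exponentials. The resulting -1 is kept as a
-- separate scalar, which supplies the extra sign in (-1)^(n+1).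
sinˢ-reflect : ∀ lam h y →
  sinˢ lam h y ≋ (-ᶜ 1ℂ) • dilate (-ᶜ 1ℂ) (sinˢ (-ᴿ lam) (-‿#0 h) y)
sinˢ-reflect lam h y n = begin
  1/2i *ᶜ (e lam h iy n -ᶜ e lam h (-ᶜ iy) n)
    ≈⟨ ℂᴿ.*-congˡ {1/2i} (ℂᴿ.+-cong (e-cong lam h (-‿involutive iy) n) ℂᴿ.refl) ⟨
  1/2i *ᶜ (e lam h (-ᶜ -ᶜ iy) n -ᶜ e lam h (-ᶜ iy) n)
    ≈⟨ ℂᴿ.*-congˡ {1/2i} (ℂᴿ.+-cong (e-reflect lam h (-ᶜ iy) n) (ℂᴿ.-‿cong (e-reflect lam h iy n))) ⟨
  1/2i *ᶜ (B *ᶜ p -ᶜ A *ᶜ p)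
    ≈⟨ ℂᴿ.*-congˡ {1/2i} (⁻¹-anti-homo‿- (A *ᶜ p) (B *ᶜ p)) ⟨
  1/2i *ᶜ -ᶜ (A *ᶜ p -ᶜ B *ᶜ p)
    ≈⟨ ℂᴿ.*-congˡ {1/2i} (ℂᴿ.-‿cong ([y-z]x≈yx-zx p A B)) ⟨
  1/2i *ᶜ -ᶜ ((A -ᶜ B) *ᶜ p)
    ≈⟨ ℂᴿ.*-congˡ {1/2i} (-1*x≈-x ((A -ᶜ B) *ᶜ p)) ⟨
  1/2i *ᶜ (-ᶜ 1ℂ *ᶜ ((A -ᶜ B) *ᶜ p))
    ≈⟨ solve 4 (λ c m d p → c :* (m :* (d :* p)) := m :* (c :* d :* p)) ℂᴿ.refl 1/2i (-ᶜ 1ℂ) (A -ᶜ B) p ⟩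
  -ᶜ 1ℂ *ᶜ (1/2i *ᶜ (A -ᶜ B) *ᶜ p) ∎
  where
  open AbelianGroupProperties ℂᴿ.+-abelianGroup using (⁻¹-anti-homo‿-)
  iy = 𝕚 *ᶜ fromℝ y
  p = (-ᶜ 1ℂ) ^ n
  A = e (-ᴿ lam) (-‿#0 h) iy n
  B = e (-ᴿ lam) (-‿#0 h) (-ᶜ iy) n

-- Handles the factor shared by the cosine and sine cases. The addition law splits e_λ^(1-x) into
-- e_λ and e_λ^(-x): the first joins the quotient to form its reflection, and the second is already
-- a reflected exponential.
t/[e-1]⊛e-reflect : ∀ lam h x →
  t/[e-1] lam h ⊛ e lam h (fromℝ (1ℝ -ᴿ x)) ≋
  dilate (-ᶜ 1ℂ) (t/[e-1] (-ᴿ lam) (-‿#0 h) ⊛ e (-ᴿ lam) (-‿#0 h) (fromℝ x))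
t/[e-1]⊛e-reflect lam h x n = begin
  (q ⊛ e lam h (fromℝ (1ℝ -ᴿ x))) n
    ≈⟨ ⊛-congˡ q (e-cong lam h (ℂᴿ.trans (fromℝ-+ 1ℝ (-ᴿ x)) (ℂᴿ.+-congˡ {1ℂ} (fromℝ-neg x)))) n ⟩
  (q ⊛ e lam h (1ℂ +ᶜ -ᶜ fromℝ x)) n
    ≈⟨ ⊛-congˡ q (e-+ lam h 1ℂ (-ᶜ fromℝ x)) n ⟨
  (q ⊛ (e lam h 1ℂ ⊛ e lam h (-ᶜ fromℝ x))) n
    ≈⟨ ⊛-assoc q (e lam h 1ℂ) (e lam h (-ᶜ fromℝ x)) n ⟨
  ((q ⊛ e lam h 1ℂ) ⊛ e lam h (-ᶜ fromℝ x)) n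
    ≈⟨ ⊛-cong (t/[e-1]-reflect lam h) (e-reflect lam h (fromℝ x)) n ⟨
  (dilate (-ᶜ 1ℂ) q′ ⊛ dilate (-ᶜ 1ℂ) (e (-ᴿ lam) (-‿#0 h) (fromℝ x))) n
    ≈⟨ dilate-⊛ (-ᶜ 1ℂ) q′ (e (-ᴿ lam) (-‿#0 h) (fromℝ x)) n ⟨
  dilate (-ᶜ 1ℂ) (q′ ⊛ e (-ᴿ lam) (-‿#0 h) (fromℝ x)) n ∎
  where
  q = t/[e-1] lam h
  q′ = t/[e-1] (-ᴿ lam) (-‿#0 h)

-- Reflection of the cosine- and sine-Bernoulli polynomials.

β-cos-reflect : ∀ lam h x y n →
  β-cos lam h n (1ℝ -ᴿ x) y ≈ (-ᶜ 1ℂ) ^ n *ᶜ β-cos (-ᴿ lam) (-‿#0 h) n x y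
β-cos-reflect lam h x y n = begin
  N *ᶜ (K ⊛ cosˢ lam h y) n
    ≈⟨ ℂᴿ.*-congˡ {N} (⊛-cong (t/[e-1]⊛e-reflect lam h x) (cosˢ-reflect lam h y) n) ⟩
  N *ᶜ (dilate (-ᶜ 1ℂ) K′ ⊛ dilate (-ᶜ 1ℂ) C) n
    ≈⟨ ℂᴿ.*-congˡ {N} (dilate-⊛ (-ᶜ 1ℂ) K′ C n) ⟨
  N *ᶜ ((K′ ⊛ C) n *ᶜ p)
    ≈⟨ solve 3 (λ N g p → N :* (g :* p) := p :* (N :* g)) ℂᴿ.refl N ((K′ ⊛ C) n) p ⟩
  p *ᶜ (N *ᶜ (K′ ⊛ C) n) ∎
  where
  N = ℕ→ℂ (n !)
  p = (-ᶜ 1ℂ) ^ n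
  K = t/[e-1] lam h ⊛ e lam h (fromℝ (1ℝ -ᴿ x))
  K′ = t/[e-1] (-ᴿ lam) (-‿#0 h) ⊛ e (-ᴿ lam) (-‿#0 h) (fromℝ x)
  C = cosˢ (-ᴿ lam) (-‿#0 h) y

-- The substitution of -t contributes (-1)^n, and the oddness of the sine one further sign.
β-sin-reflect : ∀ lam h x y n →
  β-sin lam h n (1ℝ -ᴿ x) y ≈ (-ᶜ 1ℂ) ^ suc n *ᶜ β-sin (-ᴿ lam) (-‿#0 h) n x y
β-sin-reflect lam h x y n = begin
  N *ᶜ (K ⊛ sinˢ lam h y) n
    ≈⟨ ℂᴿ.*-congˡ {N} (⊛-cong (t/[e-1]⊛e-reflect lam h x) (sinˢ-reflect lam h y) n) ⟩
  N *ᶜ (dilate (-ᶜ 1ℂ) K′ ⊛ ((-ᶜ 1ℂ) • dilate (-ᶜ 1ℂ) S)) n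
    -- The factors are swapped because `•-⊛-assoc` extracts a scalar from the left factor only.
    ≈⟨ ℂᴿ.*-congˡ {N} (⊛-comm (dilate (-ᶜ 1ℂ) K′) ((-ᶜ 1ℂ) • dilate (-ᶜ 1ℂ) S) n) ⟩
  N *ᶜ (((-ᶜ 1ℂ) • dilate (-ᶜ 1ℂ) S) ⊛ dilate (-ᶜ 1ℂ) K′) n
    ≈⟨ ℂᴿ.*-congˡ {N} (•-⊛-assoc (-ᶜ 1ℂ) (dilate (-ᶜ 1ℂ) S) (dilate (-ᶜ 1ℂ) K′) n) ⟩
  N *ᶜ (-ᶜ 1ℂ *ᶜ (dilate (-ᶜ 1ℂ) S ⊛ dilate (-ᶜ 1ℂ) K′) n)
    ≈⟨ ℂᴿ.*-congˡ {N} (ℂᴿ.*-congˡ { -ᶜ 1ℂ} (dilate-⊛ (-ᶜ 1ℂ) S K′ n)) ⟨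
  N *ᶜ (-ᶜ 1ℂ *ᶜ ((S ⊛ K′) n *ᶜ p))
    ≈⟨ ℂᴿ.*-congˡ {N} (ℂᴿ.*-congˡ { -ᶜ 1ℂ} (ℂᴿ.*-congʳ {p} (⊛-comm S K′ n))) ⟩
  N *ᶜ (-ᶜ 1ℂ *ᶜ ((K′ ⊛ S) n *ᶜ p))
    ≈⟨ solve 4 (λ N m g p → N :* (m :* (g :* p)) := m :* p :* (N :* g)) ℂᴿ.refl N (-ᶜ 1ℂ) ((K′ ⊛ S) n) p ⟩
  -ᶜ 1ℂ *ᶜ p *ᶜ (N *ᶜ (K′ ⊛ S) n) ∎
  where
  N = ℕ→ℂ (n !)
  p = (-ᶜ 1ℂ) ^ n
  K = t/[e-1] lam h ⊛ e lam h (fromℝ (1ℝ -ᴿ x))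
  K′ = t/[e-1] (-ᴿ lam) (-‿#0 h) ⊛ e (-ᴿ lam) (-‿#0 h) (fromℝ x)
  S = sinˢ (-ᴿ lam) (-‿#0 h) y

theorem3p2 : (lam : ℝ) (lam#0 : lam # 0ℝ) (x y : ℝ) (n : ℕ) →
    (β-cos lam lam#0 n (1ℝ -ᴿ x) y ≈ (-ᶜ 1ℂ) ^ n *ᶜ β-cos (-ᴿ lam) (-‿#0 lam#0) n x y)
    × (β-sin lam lam#0 n (1ℝ -ᴿ x) y ≈ (-ᶜ 1ℂ) ^ suc n *ᶜ β-sin (-ᴿ lam) (-‿#0 lam#0) n x y)
theorem3p2 lam lam#0 x y n = β-cos-reflect lam lam#0 x y n , β-sin-reflect lam lam#0 x y n
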